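{- Let $k\ge 1$ and let $\rho$ be a real number. If there exists a $\rho$-competitive deterministic algorithm for the hard $k$-taxi problem (on general metric spaces), then there exists a $\rho$-competitive deterministic algorithm for the layered width-$k$ graph traversal problem ($k$-LGT). In particular, the deterministic competitive ratio of the hard $k$-taxi problem is $\Omega(2^k)$.
   Context: **Hard $k$-taxi problem.** Let $(M,d)$ be a metric space. A configuration is a multiset of $k$ points of $M$ (the taxi positions). Given an initial configuration and a sequence of requests $\sigma=(r_1,\dots,r_n)$ with $r_i=(s_i,t_i)\in M^2$, an algorithm must move the taxis so as to serve the requests in order; a taxi serves $r_i$ by first moving to $s_i$ and then to $t_i$. The cost is the total distance travelled by all taxis, except that the movement of the serving taxi from $s_i$ to $t_i$ is not counted. An online algorithm must serve each request without knowledge of future requests. **$k$-LGT.** A searcher starts at a node $s$ of a graph with non-negative edge weights whose nodes can be partitioned into layers $L_0=\{s\},L_1,L_2,\dots$ such that all edges run between consecutive layers. Each layer contains at most $k$ nodes. The goal is to move the searcher along the edges (edges may be traversed in both directions) to some target vertex $t$ while minimizing the distance travelled by the searcher. The nodes in $L_\ell$ and the edges between $L_{\ell-1}$ and $L_\ell$ are only revealed when the searcher reaches a node in $L_{\ell-1}$. **Competitiveness.** A deterministic online algorithm is $\rho$-competitive if on every input its cost is at most $\rho$ times the optimal offline cost on that input plus a constant $c$ independent of the input sequence. For the hard $k$-taxi problem the input is the request sequence $\sigma$ and the optimal offline cost is the minimum cost of serving $\sigma$ from the same initial configuration; for $k$-LGT the optimal offline cost is the length of a shortest path from $s$ to $t$.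 The deterministic competitive ratio of a problem is the infimum of all $\rho$ such that a $\rho$-competitive deterministic algorithm exists; for the hard $k$-taxi problem, the algorithm has to work for every metric space. -}

module Defs where

open import Level using (0ℓ) renaming (suc to lsuc)
open import Algebra.Bundles using (CommutativeRing; Semiring)
open import Algebra.Core using (Op₁; Op₂)
open import Algebra.Structures using (IsCommutativeRing)
import Algebra.Definitions.RawSemiring as RawSemiringDefinitions
open import Data.Fin.Base using (Fin; zero)
open import Data.List.Base using (List; []; _∷_; _∷ʳ_; length)
open import Data.Maybe.Base using (Maybe; just)
open import Data.Nat.Base as ℕ using (ℕ)
open import Data.Product.Base using (∃; ∃-syntax; _×_; _,_)
open import Data.Vec.Base as Vec using (Vec; []; _∷_; lookup; zipWith; _[_]≔_)
open import Function.Metric.Structures using (IsGeneralMetric)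
open import Relation.Binary.Core using (Rel)
open import Relation.Binary.Structures using (IsTotalOrder)
open import Relation.Binary.PropositionalEquality.Core using (_≡_; _≢_)
import Relation.Binary.Construct.Add.Extrema.NonStrict as AddExtrema
open import Relation.Nullary.Construct.Add.Extrema using (_±; [_])
open import Relation.Unary using (Pred)

-- A Dedekind-complete ordered field; classically this determines the real
-- numbers up to unique isomorphism.

record RealNumbers : Set₁ where
  infix  4 _≤_ _<_
  infixl 6 _+_
  infixl 7 _*_
  infix  8 -_
  field
    ℝ                 : Set
    _+_ _*_           : Op₂ ℝ
    -_                : Op₁ ℝ
    0# 1#             : ℝ
    _≤_               : Rel ℝ 0ℓ
    isCommutativeRing : IsCommutativeRing _≡_ _+_ _*_ -_ 0# 1#
    isTotalOrder      : IsTotalOrder _≡_ _≤_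
    0≢1               : 0# ≢ 1#
    inverse           : ∀ x → x ≢ 0# → ∃[ y ] x * y ≡ 1#
    +-monoˡ-≤         : ∀ {x y} z → x ≤ y → x + z ≤ y + z
    *-nonNegative     : ∀ {x y} → 0# ≤ x → 0# ≤ y → 0# ≤ x * y
    supremum          : (S : Pred ℝ 0ℓ) → ∃ S →
                        (∃[ b ] ∀ x → S x → x ≤ b) →
                        ∃[ u ] (∀ x → S x → x ≤ u)
                             × (∀ b → (∀ x → S x → x ≤ b) → u ≤ b)

  commutativeRing : CommutativeRing 0ℓ 0ℓ
  commutativeRing = record { isCommutativeRing = isCommutativeRing }

  open RawSemiringDefinitions
    (Semiring.rawSemiring (CommutativeRing.semiring commutativeRing)) public
    using (_^_)

  _<_ : Rel ℝ 0ℓ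
  x < y = x ≤ y × x ≢ y

  2# : ℝ
  2# = 1# + 1#

module OverReals (𝓡 : RealNumbers) where
  open RealNumbers 𝓡

  infix 4 _∈Ω_

  IsMinimum : ∀ {ℓ} → Pred ℝ ℓ → Pred ℝ ℓ
  IsMinimum S m = S m × (∀ x → S x → m ≤ x)

  ℝ± : Set
  ℝ± = ℝ ±

  open AddExtrema _≤_ public using (_≤±_)

  -- Infimum in the extended reals: the infimum of the empty set is +∞.
  IsInfimum : ∀ {ℓ} → Pred ℝ ℓ → Pred ℝ± ℓ
  IsInfimum S r = (∀ x → S x → r ≤± [ x ])
                × (∀ b → (∀ x → S x → b ≤± [ x ]) → b ≤± r)

  _∈Ω_ : (ℕ → ℝ±) → (ℕ → ℝ) → Set
  f ∈Ω g = ∃[ c ] 0# < c × (∃[ K ] ∀ k → K ℕ.≤ k → [ c * g k ] ≤± f k)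

  record MetricSpace : Set₁ where
    field
      Point    : Set
      d        : Point → Point → ℝ
      isMetric : IsGeneralMetric _≡_ _≡_ _≤_ 0# _+_ d

  module _ (M : MetricSpace) (k : ℕ) where
    open MetricSpace M

    -- The taxis carry labels; both the cost and the rules are invariant under
    -- relabelling, so this presents multisets of k points.
    Configuration : Set
    Configuration = Vec Point k

    Request : Set
    Request = Point × Point

    -- The serving taxi, and where the taxis drive before the ride starts.  The
    -- entry of the serving taxi is ignored: it has to drive to the pick-up
    -- point.
    Action : Set
    Action = Fin k × Configuration

    travelled : Configuration → Configuration → ℝ
    travelled C D = Vec.foldr′ _+_ 0# (zipWith d C D)

    atPickUp : Request → Action → Configuration
    atPickUp (s , _) (i , D) = D [ i ]≔ s

    afterRide : Request → Action → Configuration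
    afterRide (s , t) (i , D) = D [ i ]≔ t

    serviceCost : Configuration → (σ : List Request) → Vec Action (length σ) → ℝ
    serviceCost C []      []       = 0#
    serviceCost C (r ∷ σ) (a ∷ as) =
      travelled C (atPickUp r a) + serviceCost (afterRide r a) σ as

    IsOptimalServiceCost : Configuration → List Request → Pred ℝ 0ℓ
    IsOptimalServiceCost C σ = IsMinimum (λ x → ∃[ as ] x ≡ serviceCost C σ as)

    -- The requests served so far and the current request determine the action.
    OnlineTaxi : Set
    OnlineTaxi = List Request → Request → Action

    actions : OnlineTaxi → List Request → (σ : List Request) → Vec Action (length σ)
    actions A past []      = []
    actions A past (r ∷ σ) = A past r ∷ actions A (past ∷ʳ r) σ

    IsTaxiCompetitive : ℝ → Configuration → OnlineTaxi → Set
    IsTaxiCompetitive ρ C A =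
      ∃[ c ] ∀ σ → ∃[ opt ] IsOptimalServiceCost C σ opt
                          × serviceCost C σ (actions A [] σ) ≤ ρ * opt + c

  TaxiCompetitive : ℕ → Pred ℝ (lsuc 0ℓ)
  TaxiCompetitive k ρ =
    (M : MetricSpace) (C : Configuration M k) → ∃ (IsTaxiCompetitive M k ρ C)

  TaxiCompetitiveRatio : ℕ → Pred ℝ± (lsuc 0ℓ)
  TaxiCompetitiveRatio k = IsInfimum (TaxiCompetitive k)

  -- Weights of the edges between a layer of a nodes and one of b nodes.
  Edges : ℕ → ℕ → Set
  Edges a b = Vec (Vec (Maybe ℝ) b) a

  -- The index is the size of the last layer.
  infixl 5 _▷_
  data LayeredGraph : ℕ → Set where
    start : LayeredGraph 1
    _▷_   : ∀ {a b} → LayeredGraph a → Edges a b → LayeredGraph b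

  data Vertex : ∀ {a} → LayeredGraph a → Set where
    last  : ∀ {a} {G : LayeredGraph a} → Fin a → Vertex G
    older : ∀ {a b} {G : LayeredGraph a} {E : Edges a b} → Vertex G → Vertex (G ▷ E)

  source : ∀ {a} (G : LayeredGraph a) → Vertex G
  source start   = last zero
  source (G ▷ E) = older (source G)

  data Edge : ∀ {a} (G : LayeredGraph a) → Vertex G → Vertex G → ℝ → Set where
    last  : ∀ {a b} {G : LayeredGraph a} {E : Edges a b} {i j w} →
            lookup (lookup E i) j ≡ just w → Edge (G ▷ E) (older (last i)) (last j) w
    older : ∀ {a b} {G : LayeredGraph a} {E : Edges a b} {u v w} →
            Edge G u v w → Edge (G ▷ E) (older u) (older v) w

  data Walk {a} (G : LayeredGraph a) : Vertex G → Vertex G → Set where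
    []       : ∀ {u} → Walk G u u
    forward  : ∀ {u v x w} → Edge G u v w → Walk G v x → Walk G u x
    backward : ∀ {u v x w} → Edge G v u w → Walk G v x → Walk G u x

  walkLength : ∀ {a} {G : LayeredGraph a} {u v} → Walk G u v → ℝ
  walkLength []                     = 0#
  walkLength (forward  {w = w} _ p) = w + walkLength p
  walkLength (backward {w = w} _ p) = w + walkLength p

  IsDistance : ∀ {a} (G : LayeredGraph a) → Vertex G → Vertex G → Pred ℝ 0ℓ
  IsDistance G u v = IsMinimum (λ x → ∃[ p ] x ≡ walkLength {G = G} {u} {v} p)

  data Width≤ (k : ℕ) : ∀ {a} → LayeredGraph a → Set where
    start : 1 ℕ.≤ k → Width≤ k start
    _▷_   : ∀ {a b} {G : LayeredGraph a} → Width≤ k G → b ℕ.≤ k →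
            {E : Edges a b} → Width≤ k (G ▷ E)

  NonNegativeWeights : ∀ {a} → LayeredGraph a → Set
  NonNegativeWeights G = ∀ {u v w} → Edge G u v w → 0# ≤ w

  -- The graph ends with the layer that contains the target.
  record IsInstance (k : ℕ) {a} (G : LayeredGraph a) (t : Fin a) : Set where
    field
      width       : Width≤ k G
      nonNegative : NonNegativeWeights G
      reachable   : Walk G (source G) (last t)

  -- When the searcher stands at node v of the last layer of G, the next layer
  -- and the edges E leading to it are revealed, including which node (if any)
  -- is the target t.  Nothing else is learnt before a node of the new layer is
  -- reached, so an algorithm amounts to a choice of the walk to make next.  The
  -- walk stays in the revealed graph G ▷ E; it leads to t if t has been
  -- revealed, and to some node of the new layer otherwise.  The past moves of a
  -- deterministic searcher are determined by G, so they need not be arguments.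
  -- The value 'nothing' means that the searcher gives up.
  record OnlineSearcher : Set where
    field
      advance : ∀ {a b} (G : LayeredGraph a) (E : Edges a b) (v : Fin a) →
                Maybe (∃[ j ] Walk (G ▷ E) (older (last v)) (last j))
      finish  : ∀ {a b} (G : LayeredGraph a) (E : Edges a b) (t : Fin b) (v : Fin a) →
                Maybe (Walk (G ▷ E) (older (last v)) (last t))

  module _ (A : OnlineSearcher) where
    open OnlineSearcher A

    -- With G revealed and the target not in it, the searcher gets to node v of
    -- the last layer of G after travelling distance x.
    data Arrives : ∀ {a} → LayeredGraph a → Fin a → ℝ → Set where
      start : Arrives start zero 0#
      step  : ∀ {a b} {G : LayeredGraph a} {E : Edges a b} {v x j p} →
              Arrives G v x → advance G E v ≡ just (j , p) →
              Arrives (G ▷ E) j (x + walkLength p)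

    -- On the input (G , t) the searcher reaches t after travelling distance x.
    data Finishes : ∀ {a} → LayeredGraph a → Fin a → ℝ → Set where
      start : Finishes start zero 0#
      step  : ∀ {a b} {G : LayeredGraph a} {E : Edges a b} {t v x p} →
              Arrives G v x → finish G E t v ≡ just p →
              Finishes (G ▷ E) t (x + walkLength p)

  IsLGTCompetitive : ℕ → ℝ → OnlineSearcher → Set
  IsLGTCompetitive k ρ A =
    ∃[ c ] ∀ {a} (G : LayeredGraph a) (t : Fin a) → IsInstance k G t →
      ∃[ x ] ∃[ opt ] Finishes A G t x
                    × IsDistance G (source G) (last t) opt
                    × x ≤ ρ * opt + c

  LGTCompetitive : ℕ → Pred ℝ 0ℓ
  LGTCompetitive k ρ = ∃ (IsLGTCompetitive k ρ)

{-# OPTIONS --safe #-}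
-- A searcher that has to be at one of k slots shadows k taxis standing at all
-- slots but one, plus one taxi at the last destination: the searcher is at the
-- slot without a taxi, the hole.  To move slot j from x to y, send the taxi at the
-- last destination to y and request a ride from x to y.  With its hole elsewhere a
-- configuration serves this for free; with its hole at j it either pays d(x,y) and
-- keeps its hole at j, or fills the hole with the taxi of another slot, and pays
-- exactly what the searcher pays for walking to that slot.  Any online taxi
-- algorithm can be shadowed like this without paying more than the algorithm.
--
-- For layered graph traversal the slots are the ends of shortest walks to the last
-- layer, embedded in a universal tree, and they are moved layer by layer.
--
-- The lower bound is an adversary for the slots.  Against n + 1 slots it leaves one
-- slot behind and plays recursively on the others; whenever the searcher escapes to
-- the slot left behind, the two sides exchange roles.  So the searcher pays for the
-- progress on both sides, of which the cheaper one suffices for the optimum: the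
-- ratio doubles with every slot, up to a loss made small by playing many rounds.

module Submission where

open import Defs
open import Level using (0ℓ; Lift; lift; lower) renaming (suc to lsuc)
open import Algebra.Bundles using (CommutativeRing)
open import Axiom.ExcludedMiddle using (ExcludedMiddle)
open import Data.Fin.Base using (Fin; zero; suc; punchIn; punchOut; fromℕ<)
open import Data.Fin.Permutation using (Permutation′; _⟨$⟩ʳ_; _⟨$⟩ˡ_; _∘ₚ_; transpose; inverseˡ; inverseʳ)
import Data.Fin.Permutation as Permutation
open import Data.Fin.Properties as Fin using () renaming (_≟_ to _≟ᶠ_)
open import Data.List.Base using (List; []; _∷_; _∷ʳ_; _++_; allFin; map)
open import Data.List.Membership.Propositional using (_∈_)
open import Data.List.Membership.Propositional.Properties using (∈-allFin; ∈-map⁺; ∈-++⁺ˡ; ∈-++⁺ʳ)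
open import Data.List.Relation.Unary.All as All using (All; []; _∷_)
open import Data.List.Relation.Unary.All.Properties using (∷ʳ⁺)
open import Data.List.Relation.Unary.Any using (here; there)
open import Data.Maybe.Base using (Maybe; just; nothing)
open import Data.Maybe.Properties using (just-injective)
open import Data.Nat.Base as ℕ using (ℕ; zero; suc)
import Data.Nat.Properties as ℕ
open import Data.Nat.Solver using (module +-*-Solver)
open import Data.Product.Base using (∃; ∃-syntax; Σ-syntax; -,_; _×_; _,_; proj₁; proj₂)
open import Data.Sum.Base using (_⊎_; inj₁; inj₂)
open import Data.Unit.Base using (⊤; tt)
open import Data.Vec.Base as Vec using (Vec; []; _∷_; lookup; zipWith; _[_]≔_)
open import Data.Vec.Properties using (lookup∘update; lookup∘update′; []≔-idempotent; []≔-commutes; []≔-lookup; lookup-replicate; lookup∘tabulate)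
open import Function.Base using (_∘_)
open import Function.Metric.Structures using (IsGeneralMetric)
open import Relation.Binary.Bundles using (Poset)
import Relation.Binary.Construct.Add.Extrema.NonStrict as AddExtrema
open import Relation.Binary.PropositionalEquality using (_≡_; _≢_; refl; sym; trans; cong; cong₂; subst; isEquivalence; module ≡-Reasoning)
open import Relation.Binary.Structures using (IsTotalOrder)
open import Relation.Nullary.Construct.Add.Extrema using ([_]; ⊥±; ⊤±)
open import Relation.Nullary.Decidable using (Dec; yes; no; True; toWitness; fromWitness; map′)
open import Relation.Nullary.Negation.Core using (contradiction; ¬_)
open import Relation.Unary using (Pred)

-- A taxi algorithm may have a different additive constant for every metric space and starting
-- configuration, while a searcher needs one constant for all graphs. So all graphs have to be
-- played in one space from one start: hence a universal tree, with all taxis beginning at its root.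
-- The tree only has to dominate the graph. Every extension of a slot uses a branch number that
-- occurs at no slot, so it adds its full length to the distances from all slots, and a tree
-- distance between two slots bounds the length of some walk between their vertices.
--
-- The number of slots is fixed while layers shrink and grow. This is possible because a slot may be
-- abandoned and put on top of another at no offline cost: when two slots coincide, a hole at the
-- one and a hole at the other give the same configuration.
--
-- The lower bound does not pass through graphs. It is played for the taxis directly, on the same
-- slots.

-- Arithmetic and order of the reals.

module OrderedField (em : ExcludedMiddle 0ℓ) (𝓡 : RealNumbers) where
  open RealNumbers 𝓡
  open CommutativeRing commutativeRing public
    using (+-comm; +-assoc; +-identityˡ; +-identityʳ; -‿inverseʳ; *-comm; *-assoc
          ; *-identityˡ; *-identityʳ; zeroˡ; zeroʳ; distribˡ; distribʳ; +-commutativeMonoid)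
  open CommutativeRing commutativeRing using (ring; semiring; commutativeSemiring)
  open import Algebra.Properties.Ring ring using (-‿distribˡ-*; -‿involutive)
  open import Algebra.Solver.Ring.NaturalCoefficients.Default commutativeSemiring public
    using (solve; _:+_; _:*_; _:=_; con)
  open IsTotalOrder isTotalOrder public
    using () renaming (refl to ≤-refl; trans to ≤-trans; reflexive to ≤-reflexive
                      ; antisym to ≤-antisym; total to ≤-total; isPartialOrder to ≤-isPartialOrder)

  ≤-poset : Poset _ _ _
  ≤-poset = record { isPartialOrder = ≤-isPartialOrder }

  module ≤-Reasoning where
    open import Relation.Binary.Reasoning.PartialOrder ≤-poset public

  +-mono-≤ : ∀ {x y u v} → x ≤ y → u ≤ v → x + u ≤ y + v
  +-mono-≤ {x} {y} {u} {v} x≤y u≤v = begin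
    x + u ≤⟨ +-monoˡ-≤ u x≤y ⟩
    y + u ≡⟨ +-comm y u ⟩
    u + y ≤⟨ +-monoˡ-≤ y u≤v ⟩
    v + y ≡⟨ +-comm v y ⟩
    y + v ∎
    where open ≤-Reasoning

  +-monoʳ-≤ : ∀ z {x y} → x ≤ y → z + x ≤ z + y
  +-monoʳ-≤ z = +-mono-≤ ≤-refl

  x+z-z≡x : ∀ x z → (x + z) + (- z) ≡ x
  x+z-z≡x x z = trans (+-assoc x z (- z)) (trans (cong (x +_) (-‿inverseʳ z)) (+-identityʳ x))

  +-cancelʳ-≤ : ∀ z {x y} → x + z ≤ y + z → x ≤ y
  +-cancelʳ-≤ z {x} {y} h = begin
    x               ≡⟨ x+z-z≡x x z ⟨
    (x + z) + (- z) ≤⟨ +-monoˡ-≤ (- z) h ⟩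
    (y + z) + (- z) ≡⟨ x+z-z≡x y z ⟩
    y               ∎
    where open ≤-Reasoning

  x≤x+y : ∀ {x y} → 0# ≤ y → x ≤ x + y
  x≤x+y {x} {y} 0≤y = ≤-trans (≤-reflexive (sym (+-identityʳ x))) (+-monoʳ-≤ x 0≤y)

  y≤x+y : ∀ {x y} → 0# ≤ x → y ≤ x + y
  y≤x+y {x} {y} 0≤x = ≤-trans (x≤x+y 0≤x) (≤-reflexive (+-comm y x))

  0≤x+y : ∀ {x y} → 0# ≤ x → 0# ≤ y → 0# ≤ x + y
  0≤x+y 0≤x 0≤y = ≤-trans 0≤x (x≤x+y 0≤y)

  x≤0⇒0≤-x : ∀ {x} → x ≤ 0# → 0# ≤ - x
  x≤0⇒0≤-x {x} x≤0 = begin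
    0#        ≡⟨ -‿inverseʳ x ⟨
    x + - x   ≤⟨ +-monoˡ-≤ (- x) x≤0 ⟩
    0# + - x  ≡⟨ +-identityˡ (- x) ⟩
    - x       ∎
    where open ≤-Reasoning

  0≤1 : 0# ≤ 1#
  0≤1 with ≤-total 0# 1#
  ... | inj₁ 0≤1 = 0≤1
  ... | inj₂ 1≤0 = ≤-trans (*-nonNegative 0≤-1 0≤-1) (≤-reflexive (begin-equality
    - 1# * - 1#     ≡⟨ -‿distribˡ-* 1# (- 1#) ⟨
    - (1# * - 1#)   ≡⟨ cong -_ (*-identityˡ (- 1#)) ⟩
    - (- 1#)        ≡⟨ -‿involutive 1# ⟩
    1#              ∎))
    where
    open ≤-Reasoning
    0≤-1 = x≤0⇒0≤-x 1≤0

  x≤y⇒0≤y-x : ∀ {x y} → x ≤ y → 0# ≤ y + - x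
  x≤y⇒0≤y-x {x} x≤y = ≤-trans (≤-reflexive (sym (-‿inverseʳ x))) (+-monoˡ-≤ (- x) x≤y)

  x+[y-x]≡y : ∀ x y → x + (y + - x) ≡ y
  x+[y-x]≡y x y = trans (sym (+-assoc x y (- x))) (trans (cong (_+ - x) (+-comm x y)) (x+z-z≡x y x))

  *-monoʳ-≤ : ∀ {z x y} → 0# ≤ z → x ≤ y → z * x ≤ z * y
  *-monoʳ-≤ {z} {x} {y} 0≤z x≤y = begin
    z * x                 ≤⟨ x≤x+y (*-nonNegative 0≤z (x≤y⇒0≤y-x x≤y)) ⟩
    z * x + z * (y + - x) ≡⟨ distribˡ z x (y + - x) ⟨
    z * (x + (y + - x))   ≡⟨ cong (z *_) (x+[y-x]≡y x y) ⟩
    z * y                 ∎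
    where open ≤-Reasoning

  *-monoˡ-≤ : ∀ {z x y} → 0# ≤ z → x ≤ y → x * z ≤ y * z
  *-monoˡ-≤ {z} {x} {y} 0≤z x≤y =
    ≤-trans (≤-reflexive (*-comm x z)) (≤-trans (*-monoʳ-≤ 0≤z x≤y) (≤-reflexive (*-comm z y)))

  *-antimonoʳ-≤ : ∀ {z x y} → z ≤ 0# → x ≤ y → z * y ≤ z * x
  *-antimonoʳ-≤ {z} {x} {y} z≤0 x≤y = begin
    z * y                 ≡⟨ cong (z *_) y≡x+u ⟩
    z * (x + (y + - x))   ≡⟨ distribˡ z x (y + - x) ⟩
    z * x + z * (y + - x) ≤⟨ +-monoʳ-≤ (z * x) (*-monoˡ-≤ (x≤y⇒0≤y-x x≤y) z≤0) ⟩
    z * x + 0# * (y + - x) ≡⟨ cong (z * x +_) (zeroˡ _) ⟩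
    z * x + 0#            ≡⟨ +-identityʳ (z * x) ⟩
    z * x                 ∎
    where
    open ≤-Reasoning
    y≡x+u : y ≡ x + (y + - x)
    y≡x+u = sym (x+[y-x]≡y x y)

  -- Multiplying a nonpositive inverse by the positive x would give 1 ≤ 0.
  positive-inverse : ∀ {x} → 0# < x → ∃[ y ] 0# < y × x * y ≡ 1#
  positive-inverse {x} (0≤x , 0≢x) with inverse x (λ x≡0 → 0≢x (sym x≡0))
  ... | y , xy≡1 = y , (0≤y , 0≢y) , xy≡1
    where
    0≢y : 0# ≢ y
    0≢y refl = 0≢1 (trans (sym (zeroʳ x)) xy≡1)
    0≤y : 0# ≤ y
    0≤y with ≤-total 0# y
    ... | inj₁ 0≤y = 0≤y
    ... | inj₂ y≤0 = contradiction
      (≤-antisym 0≤1 (≤-trans (≤-reflexive (sym xy≡1)) (≤-trans (*-monoʳ-≤ 0≤x y≤0) (≤-reflexive (zeroʳ x)))))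
      0≢1

  *-cancelʳ-≤ : ∀ {z x y} → 0# < z → x * z ≤ y * z → x ≤ y
  *-cancelʳ-≤ {z} {x} {y} 0<z xz≤yz with positive-inverse 0<z
  ... | u , (0≤u , _) , zu≡1 = begin
    x           ≡⟨ cancel x ⟨
    (x * z) * u ≤⟨ *-monoˡ-≤ 0≤u xz≤yz ⟩
    (y * z) * u ≡⟨ cancel y ⟩
    y           ∎
    where
    open ≤-Reasoning
    cancel : ∀ v → (v * z) * u ≡ v
    cancel v = trans (*-assoc v z u) (trans (cong (v *_) zu≡1) (*-identityʳ v))

  0<1 : 0# < 1#
  0<1 = 0≤1 , 0≢1

  0<x+y : ∀ {x y} → 0# < x → 0# ≤ y → 0# < x + y
  0<x+y {x} {y} (0≤x , 0≢x) 0≤y = 0≤x+y 0≤x 0≤y ,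
    λ 0≡x+y → 0≢x (≤-antisym 0≤x (≤-trans (x≤x+y 0≤y) (≤-reflexive (sym 0≡x+y))))

  -- A positive difference x - y, multiplied by a large e, would exceed c.
  scaled-bound⇒≤ : ∀ {x y c} → (∀ e → 0# ≤ e → x * e ≤ y * e + c) → x ≤ y
  scaled-bound⇒≤ {x} {y} {c} bound with ≤-total x y | em {x ≡ y}
  ... | inj₁ x≤y | _        = x≤y
  ... | inj₂ _   | yes refl = ≤-refl
  ... | inj₂ y≤x | no x≢y   = contradiction (≤-antisym 0≤1 1≤0) 0≢1
    where
    open ≤-Reasoning
    z = x + - y
    z+y≡x : z + y ≡ x
    z+y≡x = trans (+-assoc x (- y) y)
              (trans (cong (x +_) (trans (+-comm (- y) y) (-‿inverseʳ y))) (+-identityʳ x))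
    0<z : 0# < z
    0<z = ≤-trans (≤-reflexive (sym (-‿inverseʳ y))) (+-monoˡ-≤ (- y) y≤x) ,
          λ 0≡z → x≢y (trans (sym z+y≡x) (trans (cong (_+ y) (sym 0≡z)) (+-identityˡ y)))
    z⁻¹ = proj₁ (positive-inverse 0<z)
    0≤z⁻¹ = proj₁ (proj₁ (proj₂ (positive-inverse 0<z)))
    zz⁻¹≡1 = proj₂ (proj₂ (positive-inverse 0<z))
    z-bound : ∀ e → 0# ≤ e → z * e ≤ c
    z-bound e 0≤e = +-cancelʳ-≤ (y * e) (begin
      z * e + y * e ≡⟨ distribʳ e z y ⟨
      (z + y) * e   ≡⟨ cong (_* e) z+y≡x ⟩
      x * e         ≤⟨ bound e 0≤e ⟩
      y * e + c     ≡⟨ +-comm (y * e) c ⟩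
      c + y * e     ∎)
    0≤c : 0# ≤ c
    0≤c = ≤-trans (≤-reflexive (sym (zeroʳ z))) (z-bound 0# ≤-refl)
    1≤0 : 1# ≤ 0#
    1≤0 = +-cancelʳ-≤ c (begin
      1# + c               ≡⟨ *-identityˡ (1# + c) ⟨
      1# * (1# + c)        ≡⟨ cong (_* (1# + c)) zz⁻¹≡1 ⟨
      (z * z⁻¹) * (1# + c) ≡⟨ *-assoc z z⁻¹ (1# + c) ⟩
      z * (z⁻¹ * (1# + c)) ≤⟨ z-bound _ (*-nonNegative 0≤z⁻¹ (0≤x+y 0≤1 0≤c)) ⟩
      c                    ≡⟨ +-identityˡ c ⟨
      0# + c               ∎)

  open import Algebra.Properties.Semiring.Mult semiring public
    renaming (_×_ to _·_; ×-homo-+ to ·-homo-+; ×-assocˡ to ·-assocˡ; ×-assoc-* to ·-assoc-*)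
    using ()

  ·-nonNegative : ∀ n {x} → 0# ≤ x → 0# ≤ n · x
  ·-nonNegative zero    0≤x = ≤-refl
  ·-nonNegative (suc n) 0≤x = 0≤x+y 0≤x (·-nonNegative n 0≤x)

  ·-monoˡ-≤ : ∀ {m n x} → 0# ≤ x → m ℕ.≤ n → m · x ≤ n · x
  ·-monoˡ-≤ {n = n} 0≤x ℕ.z≤n = ·-nonNegative n 0≤x
  ·-monoˡ-≤ {x = x} 0≤x (ℕ.s≤s m≤n) = +-monoʳ-≤ x (·-monoˡ-≤ 0≤x m≤n)

  x+x≤y+y⇒x≤y : ∀ {x y} → x + x ≤ y + y → x ≤ y
  x+x≤y+y⇒x≤y {x} {y} h with ≤-total x y
  ... | inj₁ x≤y = x≤y
  ... | inj₂ y≤x = +-cancelʳ-≤ y (≤-trans (+-monoʳ-≤ x y≤x) h)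

-- The universal weighted tree as a metric space.

module TreeMetric (em : ExcludedMiddle 0ℓ) (𝓡 : RealNumbers) where
  open RealNumbers 𝓡
  open OverReals 𝓡
  open OrderedField em 𝓡
  open ≤-Reasoning

  Branch : Set
  Branch = ℕ × ℝ

  -- A node is the list of edges leading to it from the root.  Siblings are told
  -- apart by the numbers, so the tree contains every weighted tree.
  Node : Set
  Node = List Branch

  -- Edges need positive lengths for d to separate points; other labels stand for 1.
  size : Branch → ℝ
  size (_ , w) with em {0# < w}
  ... | yes _ = w
  ... | no  _ = 1#

  size-positive : ∀ e → 0# < size e
  size-positive (_ , w) with em {0# < w}
  ... | yes 0<w = 0<w
  ... | no  _   = 0<1

  size-≡ : ∀ {m w} → 0# < w → size (m , w) ≡ w
  size-≡ {w = w} 0<w with em {0# < w}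
  ... | yes _   = refl
  ... | no  0≮w = contradiction 0<w 0≮w

  depth : Node → ℝ
  depth []      = 0#
  depth (e ∷ P) = size e + depth P

  depth-nonNegative : ∀ P → 0# ≤ depth P
  depth-nonNegative []      = ≤-refl
  depth-nonNegative (e ∷ P) = 0≤x+y (proj₁ (size-positive e)) (depth-nonNegative P)

  depth-positive : ∀ e P → 0# < depth (e ∷ P)
  depth-positive e P = 0<x+y (size-positive e) (depth-nonNegative P)

  d : Node → Node → ℝ
  d []      R       = depth R
  d (e ∷ P) []      = depth (e ∷ P)
  d (e ∷ P) (f ∷ R) with em {e ≡ f}
  ... | yes _ = d P R
  ... | no  _ = depth (e ∷ P) + depth (f ∷ R)

  d-[]ʳ : ∀ P → d P [] ≡ depth P
  d-[]ʳ []      = refl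
  d-[]ʳ (_ ∷ _) = refl

  d-nonNegative : ∀ P R → 0# ≤ d P R
  d-nonNegative []      R       = depth-nonNegative R
  d-nonNegative (e ∷ P) []      = depth-nonNegative (e ∷ P)
  d-nonNegative (e ∷ P) (f ∷ R) with em {e ≡ f}
  ... | yes _ = d-nonNegative P R
  ... | no  _ = 0≤x+y (depth-nonNegative (e ∷ P)) (depth-nonNegative (f ∷ R))

  d-refl : ∀ P → d P P ≡ 0#
  d-refl []      = refl
  d-refl (e ∷ P) with em {e ≡ e}
  ... | yes _  = d-refl P
  ... | no e≢e = contradiction refl e≢e

  d-separates : ∀ P R → d P R ≡ 0# → P ≡ R
  d-separates []      []      _   = refl
  d-separates []      (f ∷ R) d≡0 = contradiction (sym d≡0) (proj₂ (depth-positive f R))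
  d-separates (e ∷ P) []      d≡0 = contradiction (sym d≡0) (proj₂ (depth-positive e P))
  d-separates (e ∷ P) (f ∷ R) d≡0 with em {e ≡ f}
  ... | yes refl = cong (e ∷_) (d-separates P R d≡0)
  ... | no  _    = contradiction (sym d≡0)
                     (proj₂ (0<x+y (depth-positive e P) (depth-nonNegative (f ∷ R))))

  d-sym : ∀ P R → d P R ≡ d R P
  d-sym []      R       = sym (d-[]ʳ R)
  d-sym (e ∷ P) []      = refl
  d-sym (e ∷ P) (f ∷ R) with em {e ≡ f} | em {f ≡ e}
  ... | yes _   | yes _   = d-sym P R
  ... | yes e≡f | no  f≢e = contradiction (sym e≡f) f≢e
  ... | no  e≢f | yes f≡e = contradiction (sym f≡e) e≢f
  ... | no  _   | no  _   = +-comm (depth (e ∷ P)) (depth (f ∷ R))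

  d≤depth+depth : ∀ P R → d P R ≤ depth P + depth R
  d≤depth+depth []      R       = y≤x+y ≤-refl
  d≤depth+depth (e ∷ P) []      = x≤x+y ≤-refl
  d≤depth+depth (e ∷ P) (f ∷ R) with em {e ≡ f}
  ... | yes _ = ≤-trans (d≤depth+depth P R)
                  (+-mono-≤ (y≤x+y (proj₁ (size-positive e))) (y≤x+y (proj₁ (size-positive f))))
  ... | no  _ = ≤-refl

  depth≤d+depth : ∀ P R → depth P ≤ d P R + depth R
  depth≤d+depth []      R       = 0≤x+y (depth-nonNegative R) (depth-nonNegative R)
  depth≤d+depth (e ∷ P) []      = x≤x+y ≤-refl
  depth≤d+depth (e ∷ P) (f ∷ R) with em {e ≡ f}
  ... | yes refl = begin
    size e + depth P           ≤⟨ +-monoʳ-≤ (size e) (depth≤d+depth P R) ⟩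
    size e + (d P R + depth R) ≡⟨ solve 3 (λ a b c → a :+ (b :+ c) := b :+ (a :+ c)) refl (size e) (d P R) (depth R) ⟩
    d P R + (size e + depth R) ∎
  ... | no  _    = ≤-trans (x≤x+y (depth-nonNegative (f ∷ R))) (x≤x+y (depth-nonNegative (f ∷ R)))

  d-triangle : ∀ P R S → d P S ≤ d P R + d R S
  d-triangle []      R       S       = ≤-trans (depth≤d+depth S R)
    (≤-reflexive (trans (+-comm (d S R) (depth R)) (cong (depth R +_) (d-sym S R))))
  d-triangle (e ∷ P) []      S       = d≤depth+depth (e ∷ P) S
  d-triangle (e ∷ P) (f ∷ R) []      = depth≤d+depth (e ∷ P) (f ∷ R)
  d-triangle (e ∷ P) (f ∷ R) (g ∷ S) with em {e ≡ f} | em {f ≡ g} | em {e ≡ g}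
  ... | yes _    | yes _    | yes _   = d-triangle P R S
  ... | yes refl | yes refl | no  e≢g = contradiction refl e≢g
  ... | yes refl | no  e≢g  | yes e≡g = contradiction e≡g e≢g
  ... | yes refl | no  _    | no  _   = begin
    (size e + depth P) + depth (g ∷ S)            ≤⟨ +-monoˡ-≤ _ (+-monoʳ-≤ (size e) (depth≤d+depth P R)) ⟩
    (size e + (d P R + depth R)) + depth (g ∷ S)  ≡⟨ solve 4 (λ a b c x → (a :+ (b :+ c)) :+ x := b :+ ((a :+ c) :+ x)) refl (size e) (d P R) (depth R) (depth (g ∷ S)) ⟩
    d P R + ((size e + depth R) + depth (g ∷ S))  ∎
  ... | no  e≢f  | yes refl | yes e≡f = contradiction e≡f e≢f
  ... | no  _    | yes refl | no  _   = begin
    depth (e ∷ P) + (size f + depth S)            ≤⟨ +-monoʳ-≤ (depth (e ∷ P)) (+-monoʳ-≤ (size f) (depth≤d+depth S R)) ⟩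
    depth (e ∷ P) + (size f + (d S R + depth R))  ≡⟨ cong (λ u → depth (e ∷ P) + (size f + (u + depth R))) (d-sym S R) ⟩
    depth (e ∷ P) + (size f + (d R S + depth R))  ≡⟨ solve 4 (λ a b c x → x :+ (a :+ (b :+ c)) := (x :+ (a :+ c)) :+ b) refl (size f) (d R S) (depth R) (depth (e ∷ P)) ⟩
    (depth (e ∷ P) + (size f + depth R)) + d R S  ∎
  ... | no  _    | no  _    | yes refl = begin
    d P S                                                           ≤⟨ d≤depth+depth P S ⟩
    depth P + depth S                                               ≤⟨ +-mono-≤ (y≤x+y (proj₁ (size-positive e))) (y≤x+y (proj₁ (size-positive e))) ⟩
    depth (e ∷ P) + depth (e ∷ S)                                   ≤⟨ +-mono-≤ (x≤x+y (depth-nonNegative (f ∷ R))) (y≤x+y (depth-nonNegative (f ∷ R))) ⟩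
    (depth (e ∷ P) + depth (f ∷ R)) + (depth (f ∷ R) + depth (e ∷ S)) ∎
  ... | no  _    | no  _    | no  _   = +-mono-≤ (x≤x+y (depth-nonNegative (f ∷ R))) (y≤x+y (depth-nonNegative (f ∷ R)))

  tree : MetricSpace
  tree = record
    { Point    = Node
    ; d        = d
    ; isMetric = record
      { isSemiMetric = record
        { isQuasiSemiMetric = record
          { isPreMetric = record
            { isProtoMetric = record
              { isPartialOrder  = ≤-isPartialOrder
              ; ≈-isEquivalence = isEquivalence
              ; cong            = λ { refl refl → refl }
              ; nonNegative     = λ {P} {R} → d-nonNegative P R
              }
            ; ≈⇒0 = λ { {P} refl → d-refl P }
            }
          ; 0⇒≈ = λ {P} {R} → d-separates P R
          }
        ; sym = d-sym
        }
      ; triangle = d-triangle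
      }
    }

  Below : ℕ → Node → Set
  Below n = All (λ e → proj₁ e ℕ.< n)

  -- A zero-length extension must be the node itself.
  grow : Node → ℕ → ℝ → Node
  grow P n w with em {w ≡ 0#}
  ... | yes _ = P
  ... | no  _ = P ∷ʳ (n , w)

  -- The number `n` does not occur on `R`, so the new edge is not shared with `R`, and the path from
  -- `R` to the new node has to end with it.
  d-fresh : ∀ {n w} P R → 0# < w → Below n R → d R (P ∷ʳ (n , w)) ≡ d R P + w
  d-fresh {n} {w} [] [] 0<w _ = trans (+-identityʳ _) (trans (size-≡ {n} 0<w) (sym (+-identityˡ w)))
  d-fresh {n} {w} [] (f ∷ R) 0<w (f<n ∷ _) with em {f ≡ (n , w)}
  ... | yes refl = contradiction f<n (ℕ.n≮n n)
  ... | no  _    = cong (depth (f ∷ R) +_) (trans (+-identityʳ _) (size-≡ {n} 0<w))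
  d-fresh (e ∷ P) [] 0<w [] = trans (cong (size e +_) (d-fresh P [] 0<w [])) (sym (+-assoc _ _ _))
  d-fresh (e ∷ P) (f ∷ R) 0<w (f<n ∷ R<n) with em {f ≡ e}
  ... | yes _ = d-fresh P R 0<w R<n
  ... | no  _ = trans (cong (λ u → depth (f ∷ R) + (size e + u)) (d-fresh P [] 0<w []))
                  (solve 4 (λ a b c x → a :+ (b :+ (c :+ x)) := (a :+ (b :+ c)) :+ x) refl (depth (f ∷ R)) (size e) (depth P) _)

  d-grow : ∀ {n w} P R → 0# ≤ w → Below n R → d R (grow P n w) ≡ d R P + w
  d-grow {n} {w} P R 0≤w R<n with em {w ≡ 0#}
  ... | yes refl = sym (+-identityʳ _)
  ... | no  w≢0  = d-fresh P R (0≤w , λ 0≡w → w≢0 (sym 0≡w)) R<n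

  grow-below : ∀ {n} P w → Below n P → Below (suc n) (grow P n w)
  grow-below {n} P w P<n with em {w ≡ 0#}
  ... | yes _ = All.map ℕ.m<n⇒m<1+n P<n
  ... | no  _ = ∷ʳ⁺ (All.map ℕ.m<n⇒m<1+n P<n) (ℕ.n<1+n n)

-- Finite sums of reals.

module FiniteSums (em : ExcludedMiddle 0ℓ) (𝓡 : RealNumbers) where
  open RealNumbers 𝓡
  open OrderedField em 𝓡
  open import Algebra.Properties.CommutativeMonoid.Sum +-commutativeMonoid public
    using (sum; ∑-distrib-+; sum-permute; sum-cong-≗)

  sum-mono-≤ : ∀ {n} {f g : Fin n → ℝ} → (∀ i → f i ≤ g i) → sum f ≤ sum g
  sum-mono-≤ {zero}  f≤g = ≤-refl
  sum-mono-≤ {suc n} f≤g = +-mono-≤ (f≤g zero) (sum-mono-≤ (f≤g ∘ suc))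

  sum-nonNegative : ∀ {n} {f : Fin n → ℝ} → (∀ i → 0# ≤ f i) → 0# ≤ sum f
  sum-nonNegative {zero}  0≤f = ≤-refl
  sum-nonNegative {suc n} 0≤f = 0≤x+y (0≤f zero) (sum-nonNegative (0≤f ∘ suc))

  term≤sum : ∀ {n} {f : Fin n → ℝ} → (∀ i → 0# ≤ f i) → ∀ i → f i ≤ sum f
  term≤sum 0≤f zero    = x≤x+y (sum-nonNegative (0≤f ∘ suc))
  term≤sum 0≤f (suc i) = ≤-trans (term≤sum (0≤f ∘ suc) i) (y≤x+y (0≤f zero))

  -- Subtraction-free form of the fact that the two sums differ by `f l - g l`.
  sum-exchange : ∀ {n} {f g : Fin n → ℝ} l → (∀ i → i ≢ l → f i ≡ g i) → sum f + g l ≡ sum g + f l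
  sum-exchange {f = f} {g} zero f≗g = trans
    (cong (λ u → (f zero + u) + g zero) (sum-cong-≗ (λ i → f≗g (suc i) λ ())))
    (solve 3 (λ a b c → (a :+ b) :+ c := (c :+ b) :+ a) refl (f zero) (sum (g ∘ suc)) (g zero))
  sum-exchange {f = f} {g} (suc l) f≗g = begin
    (f zero + sum (f ∘ suc)) + g (suc l) ≡⟨ +-assoc _ _ _ ⟩
    f zero + (sum (f ∘ suc) + g (suc l)) ≡⟨ cong₂ _+_ (f≗g zero λ ()) (sum-exchange l λ i i≢l → f≗g (suc i) (i≢l ∘ Fin.suc-injective)) ⟩
    g zero + (sum (g ∘ suc) + f (suc l)) ≡⟨ +-assoc _ _ _ ⟨
    (g zero + sum (g ∘ suc)) + f (suc l) ∎
    where open ≡-Reasoning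

-- Shadowing a taxi algorithm, with a matching as potential.

module LazySimulation (em : ExcludedMiddle 0ℓ) (𝓡 : RealNumbers)
                      (M : OverReals.MetricSpace 𝓡) (k : ℕ) where
  open RealNumbers 𝓡
  open OverReals 𝓡 hiding (Configuration; Request; Action; OnlineTaxi; travelled; atPickUp; afterRide; serviceCost; actions)
  open OrderedField em 𝓡
  open FiniteSums em 𝓡
  open MetricSpace M
  open IsGeneralMetric isMetric using (≈⇒0; nonNegative; triangle) renaming (sym to d-sym)

  Configuration = OverReals.Configuration 𝓡 M k
  Request       = OverReals.Request 𝓡 M k
  Action        = OverReals.Action 𝓡 M k
  OnlineTaxi    = OverReals.OnlineTaxi 𝓡 M k
  travelled     = OverReals.travelled 𝓡 M k
  atPickUp      = OverReals.atPickUp 𝓡 M k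
  afterRide     = OverReals.afterRide 𝓡 M k
  serviceCost   = OverReals.serviceCost 𝓡 M k
  actions       = OverReals.actions 𝓡 M k

  private
    travel : ∀ {n} → Vec Point n → Vec Point n → ℝ
    travel C D = Vec.foldr′ _+_ 0# (zipWith d C D)

  travelled≡sum : ∀ {n} (C D : Vec Point n) → travel C D ≡ sum (λ i → d (lookup C i) (lookup D i))
  travelled≡sum []      []      = refl
  travelled≡sum (P ∷ C) (R ∷ D) = cong (d P R +_) (travelled≡sum C D)

  travelled-nonNegative : ∀ {n} (C D : Vec Point n) → 0# ≤ travel C D
  travelled-nonNegative C D = ≤-trans
    (sum-nonNegative {f = λ i → d (lookup C i) (lookup D i)} λ _ → nonNegative)
    (≤-reflexive (sym (travelled≡sum C D)))

  distance≤travelled : ∀ {n} (C D : Vec Point n) i → d (lookup C i) (lookup D i) ≤ travel C D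
  distance≤travelled C D i = ≤-trans
    (term≤sum {f = λ i → d (lookup C i) (lookup D i)} (λ _ → nonNegative) i)
    (≤-reflexive (sym (travelled≡sum C D)))

  travelled-refl : ∀ {n} (C : Vec Point n) → travel C C ≡ 0#
  travelled-refl []      = refl
  travelled-refl (P ∷ C) = trans (cong₂ _+_ (≈⇒0 refl) (travelled-refl C)) (+-identityˡ 0#)

  travelled-single : ∀ {n} (C : Vec Point n) i P → travel C (C [ i ]≔ P) ≡ d (lookup C i) P
  travelled-single (R ∷ C) zero    P = trans (cong (d R P +_) (travelled-refl C)) (+-identityʳ _)
  travelled-single (R ∷ C) (suc i) P = trans (cong₂ _+_ (≈⇒0 refl) (travelled-single C i P)) (+-identityˡ _)

  -- `serviceCost` takes a vector of actions indexed by the length of the request list and does not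
  -- show the final configuration. This relation does, and it can be continued by one more request
  -- at the end, as adaptive play requires.
  data Serves : Configuration → List Request → Configuration → ℝ → Set where
    []  : ∀ {C} → Serves C [] C 0#
    _∷_ : ∀ {C r σ D x} a → Serves (afterRide r a) σ D x →
          Serves C (r ∷ σ) D (travelled C (atPickUp r a) + x)

  Serves⇒serviceCost : ∀ {C σ D x} → Serves C σ D x → ∃[ as ] x ≡ serviceCost C σ as
  Serves⇒serviceCost []      = [] , refl
  Serves⇒serviceCost (a ∷ s) with Serves⇒serviceCost s
  ... | as , refl = a ∷ as , refl

  Serves-∷ʳ : ∀ {C σ D x} → Serves C σ D x → ∀ s t m →
              Serves C (σ ∷ʳ (s , t)) (D [ m ]≔ t) (x + d (lookup D m) s)
  Serves-∷ʳ {D = D} [] s t m = subst (Serves D _ _)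
    (trans (+-identityʳ _) (trans (travelled-single D m s) (sym (+-identityˡ _))))
    ((m , D) ∷ [])
  Serves-∷ʳ {C} (a ∷ σ) s t m = subst (Serves C _ _) (sym (+-assoc _ _ _)) (a ∷ Serves-∷ʳ σ s t m)

  module _ (A : OnlineTaxi) where

    data Follows : List Request → Configuration → List Request → Configuration → ℝ → Set where
      []   : ∀ {past C} → Follows past C [] C 0#
      next : ∀ {past C r σ D x} → Follows (past ∷ʳ r) (afterRide r (A past r)) σ D x →
             Follows past C (r ∷ σ) D (travelled C (atPickUp r (A past r)) + x)

    Follows⇒serviceCost : ∀ {past C σ D x} → Follows past C σ D x →
                          x ≡ serviceCost C σ (actions A past σ)
    Follows⇒serviceCost []       = refl
    Follows⇒serviceCost (next f) = cong (_ +_) (Follows⇒serviceCost f)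

    Follows-∷ʳ : ∀ {past C σ D x} → Follows past C σ D x → ∀ r →
                 ∃[ a ] Follows past C (σ ∷ʳ r) (afterRide r a) (x + travelled D (atPickUp r a))
    Follows-∷ʳ {past} {C} [] r = A past r , subst (Follows past C _ _)
      (trans (+-identityʳ _) (sym (+-identityˡ _))) (next [])
    Follows-∷ʳ {past} {C} (next f) r with Follows-∷ʳ f r
    ... | a , f′ = a , subst (Follows past C _ _) (sym (+-assoc _ _ _)) (next f′)

    gap : Permutation′ k → Configuration → Configuration → ℝ
    gap π H B = sum (λ l → d (lookup H l) (lookup B (π ⟨$⟩ʳ l)))

    -- A potential argument: the shadowing taxis at `H` have paid `x`, and what the algorithm has
    -- spent beyond that would still let them catch up with `B` along the matching `π`. Any matching
    -- will do; minimality is never asked for.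
    record Lag (x : ℝ) (H B : Configuration) (y : ℝ) : Set where
      constructor matched
      field
        π     : Permutation′ k
        bound : x + gap π H B ≤ y

    lag⇒≤ : ∀ {x H B y} → Lag x H B y → x ≤ y
    lag⇒≤ {H = H} {B} (matched π h) = ≤-trans
      (x≤x+y (sum-nonNegative {f = λ l → d (lookup H l) (lookup B (π ⟨$⟩ʳ l))} λ _ → nonNegative)) h

    lag-travel : ∀ {x H B y} → Lag x H B y → ∀ D → Lag x H D (y + travelled B D)
    lag-travel {x} {H} {B} {y} (matched π h) D = matched π (begin
      x + gap π H D                          ≤⟨ +-monoʳ-≤ x (sum-mono-≤ {f = λ l → d (lookup H l) (lookup D (π ⟨$⟩ʳ l))} λ l → triangle _ (lookup B (π ⟨$⟩ʳ l)) _) ⟩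
      x + sum (λ l → d (lookup H l) (lookup B (π ⟨$⟩ʳ l)) + moved (π ⟨$⟩ʳ l))
                                             ≡⟨ cong (x +_) (∑-distrib-+ (λ l → d (lookup H l) (lookup B (π ⟨$⟩ʳ l))) (λ l → moved (π ⟨$⟩ʳ l))) ⟩
      x + (gap π H B + sum (λ l → moved (π ⟨$⟩ʳ l)))
                                             ≡⟨ cong (λ u → x + (gap π H B + u)) (sum-permute moved π) ⟨
      x + (gap π H B + sum moved)            ≡⟨ cong (λ u → x + (gap π H B + u)) (travelled≡sum B D) ⟨
      x + (gap π H B + travelled B D)        ≡⟨ +-assoc _ _ _ ⟨
      (x + gap π H B) + travelled B D        ≤⟨ +-monoˡ-≤ _ h ⟩
      y + travelled B D                      ∎)
      where
      open ≤-Reasoning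
      moved : Fin k → ℝ
      moved i = d (lookup B i) (lookup D i)

    -- A refund: moving taxi `l` widens the gap by at most the distance moved, and this is covered
    -- by taking back the same amount from what has been paid. It is used to cancel an unwanted
    -- drive.
    lag-move : ∀ {x H B y} l P → Lag (x + d (lookup H l) P) H B y → Lag x (H [ l ]≔ P) B y
    lag-move {x} {H} {B} {y} l P (matched π h) = matched π (begin
      x + gap π (H [ l ]≔ P) B                ≤⟨ +-monoʳ-≤ x (sum-mono-≤ {f = λ i → d (lookup (H [ l ]≔ P) i) (lookup B (π ⟨$⟩ʳ i))} λ i → triangle _ (lookup H i) _) ⟩
      x + sum (λ i → d (lookup (H [ l ]≔ P) i) (lookup H i) + d (lookup H i) (lookup B (π ⟨$⟩ʳ i)))
                                              ≡⟨ cong (x +_) (∑-distrib-+ (λ i → d (lookup (H [ l ]≔ P) i) (lookup H i)) _) ⟩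
      x + (sum (λ i → d (lookup (H [ l ]≔ P) i) (lookup H i)) + gap π H B)
                                              ≡⟨ cong (λ u → x + (u + gap π H B)) (sum-cong-≗ λ i → d-sym (lookup (H [ l ]≔ P) i) (lookup H i)) ⟩
      x + (sum (λ i → d (lookup H i) (lookup (H [ l ]≔ P) i)) + gap π H B)
                                              ≡⟨ cong (λ u → x + (u + gap π H B)) (travelled≡sum H (H [ l ]≔ P)) ⟨
      x + (travelled H (H [ l ]≔ P) + gap π H B) ≡⟨ cong (λ u → x + (u + gap π H B)) (travelled-single H l P) ⟩
      x + (d (lookup H l) P + gap π H B)      ≡⟨ +-assoc _ _ _ ⟨
      (x + d (lookup H l) P) + gap π H B      ≤⟨ h ⟩
      y                                       ∎)
      where open ≤-Reasoning

    lag-permute : ∀ {x H H′ B y} (τ : Permutation′ k) →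
                  (∀ i → lookup H′ i ≡ lookup H (τ ⟨$⟩ʳ i)) → Lag x H B y → Lag x H′ B y
    lag-permute {x} {H} {H′} {B} τ H′≗H (matched π h) = matched (τ ∘ₚ π) (≤-trans (≤-reflexive (cong (x +_) (trans
      (sum-cong-≗ λ i → cong (λ P → d P (lookup B (π ⟨$⟩ʳ (τ ⟨$⟩ʳ i)))) (H′≗H i))
      (sym (sum-permute (λ i → d (lookup H i) (lookup B (π ⟨$⟩ʳ i))) τ))))) h)

    -- The serving taxi `l` is the partner of the algorithm's taxi `a`. Its drive to `s` turns its
    -- term of the gap into payment, and after the ride both partners stand at `t`, so that term
    -- vanishes.
    lag-serve : ∀ {x H B y} a s t → Lag x H (B [ a ]≔ s) y →
                ∃[ l ] Lag (x + d (lookup H l) s) (H [ l ]≔ t) (B [ a ]≔ t) y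
    lag-serve {x} {H} {B} {y} a s t (matched π h) = l , matched π (begin
      (x + d (lookup H l) s) + sum g   ≡⟨ solve 3 (λ a b c → (a :+ b) :+ c := a :+ (c :+ b)) refl x _ (sum g) ⟩
      x + (sum g + d (lookup H l) s)   ≡⟨ cong (λ P → x + (sum g + d (lookup H l) P)) (sym (trans (cong (lookup (B [ a ]≔ s)) (inverseʳ π)) (lookup∘update a B s))) ⟩
      x + (sum g + f l)                ≡⟨ cong (x +_) (sum-exchange l f≗g) ⟨
      x + (sum f + g l)                ≡⟨ cong (λ u → x + (sum f + u)) g[l]≡0 ⟩
      x + (sum f + 0#)                 ≡⟨ cong (x +_) (+-identityʳ _) ⟩
      x + sum f                        ≤⟨ h ⟩
      y                                ∎)
      where
      open ≤-Reasoning
      l = π ⟨$⟩ˡ a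
      f g : Fin k → ℝ
      f i = d (lookup H i) (lookup (B [ a ]≔ s) (π ⟨$⟩ʳ i))
      g i = d (lookup (H [ l ]≔ t) i) (lookup (B [ a ]≔ t) (π ⟨$⟩ʳ i))
      g[l]≡0 : g l ≡ 0#
      g[l]≡0 = ≈⇒0 (trans (lookup∘update l H t)
        (sym (trans (cong (lookup (B [ a ]≔ t)) (inverseʳ π)) (lookup∘update a B t))))
      f≗g : ∀ i → i ≢ l → f i ≡ g i
      f≗g i i≢l = cong₂ d (sym (lookup∘update′ i≢l H t))
        (trans (lookup∘update′ πi≢a B s) (sym (lookup∘update′ πi≢a B t)))
        where
        πi≢a : π ⟨$⟩ʳ i ≢ a
        πi≢a πi≡a = i≢l (trans (sym (inverseˡ π)) (cong (π ⟨$⟩ˡ_) πi≡a))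

    -- If the matched taxi l is not the free one, exchange the roles of l and m.
    lag-serve-free : ∀ {x H B y} a s t m → lookup H m ≡ s → Lag x H (B [ a ]≔ s) y →
                     Lag x (H [ m ]≔ t) (B [ a ]≔ t) y
    lag-serve-free {x} {H} {B} {y} a s t m Hm≡s lag with lag-serve a s t lag
    ... | l , lag′ with l ≟ᶠ m
    ... | yes refl = subst (λ u → Lag u (H [ m ]≔ t) (B [ a ]≔ t) y)
                       (trans (cong (x +_) (≈⇒0 Hm≡s)) (+-identityʳ x)) lag′
    ... | no  l≢m  = lag-permute (transpose l m) exchanged
                       (lag-move m (lookup H l) (subst (λ u → Lag (x + u) (H [ l ]≔ t) (B [ a ]≔ t) y) cost lag′))
      where
      cost : d (lookup H l) s ≡ d (lookup (H [ l ]≔ t) m) (lookup H l)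
      cost = trans (d-sym _ _) (cong (λ P → d P (lookup H l)) (sym (trans (lookup∘update′ (l≢m ∘ sym) H t) Hm≡s)))
      exchanged : ∀ i → lookup (H [ m ]≔ t) i ≡
                        lookup ((H [ l ]≔ t) [ m ]≔ lookup H l) (transpose l m ⟨$⟩ʳ i)
      exchanged i with i ≟ᶠ l
      ... | yes refl = trans (lookup∘update′ l≢m H t) (sym (lookup∘update m (H [ l ]≔ t) (lookup H l)))
      ... | no  i≢l with i ≟ᶠ m
      ...   | yes refl = trans (lookup∘update m H t)
                (sym (trans (lookup∘update′ l≢m (H [ l ]≔ t) _) (lookup∘update l H t)))
      ...   | no  i≢m  = trans (lookup∘update′ i≢m H t)
                (sym (trans (lookup∘update′ i≢m (H [ l ]≔ t) _) (lookup∘update′ i≢l H t)))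

    -- A lazy searcher in configuration H that has paid x, shadowing the run of A on σ.
    record Online (C₀ : Configuration) (σ : List Request) (H : Configuration) (x : ℝ) : Set where
      constructor online
      field
        {taxis} : Configuration
        {cost}  : ℝ
        follows : Follows [] C₀ σ taxis cost
        lag     : Lag x H taxis cost

    Online-[] : ∀ {C₀} → Online C₀ [] C₀ 0#
    Online-[] {C₀} = online [] (matched Permutation.id
      (≤-reflexive (trans (+-identityˡ _) (trans (sym (travelled≡sum C₀ C₀)) (travelled-refl C₀)))))

    Online-pays : ∀ {C₀ σ H x} s t → Online C₀ σ H x →
                  ∃[ l ] Online C₀ (σ ∷ʳ (s , t)) (H [ l ]≔ t) (x + d (lookup H l) s)
    Online-pays s t (online f lag) with Follows-∷ʳ f (s , t)
    ... | (a , D) , f′ with lag-serve a s t (lag-travel lag (D [ a ]≔ s))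
    ...   | l , lag′ = l , online f′ lag′

    Online-free : ∀ {C₀ σ H x} s t m → lookup H m ≡ s → Online C₀ σ H x →
                  Online C₀ (σ ∷ʳ (s , t)) (H [ m ]≔ t) x
    Online-free s t m Hm≡s (online f lag) with Follows-∷ʳ f (s , t)
    ... | (a , D) , f′ = online f′ (lag-serve-free a s t m Hm≡s (lag-travel lag (D [ a ]≔ s)))

-- The game of slots and its moves.

module SlotGame (em : ExcludedMiddle 0ℓ) (𝓡 : RealNumbers) (k : ℕ)
                (A : OverReals.OnlineTaxi 𝓡 (TreeMetric.tree em 𝓡) k) where
  open RealNumbers 𝓡
  open OrderedField em 𝓡
  open TreeMetric em 𝓡
  open LazySimulation em 𝓡 tree k

  root : Configuration
  root = Vec.replicate k []

  Serves-resp-≡ : ∀ {σ C C′ z z′} → C ≡ C′ → z ≡ z′ → Serves root σ C z → Serves root σ C′ z′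
  Serves-resp-≡ refl refl s = s

  Online-resp-≡ : ∀ {σ C C′ x} → C ≡ C′ → Online A root σ C x → Online A root σ C′ x
  Online-resp-≡ refl o = o

  -- There are k slots and k taxis, one of them at the last destination p.  The
  -- searcher stands at the slot without a taxi, called the hole.  Serving all
  -- requests with the final hole at slot i costs at most bound i offline.
  record Game (X : Set) : Set where
    field
      {requests} : List Request
      p          : Node
      slot       : Vec Node k
      tag        : Vec X k
      bound      : Vec ℝ k
      hole       : Fin k
      paid       : ℝ
      offline    : ∀ i → ∃[ z ] Serves root requests (slot [ i ]≔ p) z × z ≤ lookup bound i
      simulates  : Online A root requests (slot [ hole ]≔ p) paid
      fresh      : ℕ
      below      : ∀ i → Below fresh (lookup slot i)

    at : Fin k → Node
    at = lookup slot

    tagOf : Fin k → X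
    tagOf = lookup tag

    boundOf : Fin k → ℝ
    boundOf = lookup bound

  open Game

  -- In `jumps` the distance ends at the old position of `j`, since the taxi of slot `l` drives to
  -- the pick-up point and the ride to `P` is not charged. In `follows` the taxi that was sent ahead
  -- to `P` drives back to the pick-up point and rides to `P` again.
  data Response {X} (S S′ : Game X) (j : Fin k) (P : Node) : Set where
    elsewhere : hole S ≢ j → hole S′ ≡ hole S → paid S′ ≡ paid S → Response S S′ j P
    follows   : hole S ≡ j → hole S′ ≡ j → paid S′ ≡ paid S + d (at S j) P → Response S S′ j P
    jumps     : ∀ {l} → hole S ≡ j → l ≢ j → hole S′ ≡ l → paid S′ ≡ paid S + d (at S l) (at S j) → Response S S′ j P

  record Shifted {X} (S S′ : Game X) (j : Fin k) (P : Node) (v : X) (b : ℝ) : Set where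
    field
      slot-≡   : slot S′ ≡ slot S [ j ]≔ P
      tag-≡    : tag S′ ≡ tag S [ j ]≔ v
      bound-≡  : bound S′ ≡ bound S [ j ]≔ b
      response : Response S S′ j P

    at-self : at S′ j ≡ P
    at-self = trans (cong (λ C → lookup C j) slot-≡) (lookup∘update j (slot S) P)
    at-other : ∀ {l} → l ≢ j → at S′ l ≡ at S l
    at-other {l} l≢j = trans (cong (λ C → lookup C l) slot-≡) (lookup∘update′ l≢j (slot S) P)
    tag-self : tagOf S′ j ≡ v
    tag-self = trans (cong (λ C → lookup C j) tag-≡) (lookup∘update j (tag S) v)
    tag-other : ∀ {l} → l ≢ j → tagOf S′ l ≡ tagOf S l
    tag-other {l} l≢j = trans (cong (λ C → lookup C l) tag-≡) (lookup∘update′ l≢j (tag S) v)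
    bound-self : boundOf S′ j ≡ b
    bound-self = trans (cong (λ C → lookup C j) bound-≡) (lookup∘update j (bound S) b)
    bound-other : ∀ {l} → l ≢ j → boundOf S′ l ≡ boundOf S l
    bound-other {l} l≢j = trans (cong (λ C → lookup C l) bound-≡) (lookup∘update′ l≢j (bound S) b)

  -- Either the hole stays at `j` and the distance is paid, or slot `m` is already at `P`. In the
  -- second case the configurations with holes at `m` and at `j` coincide after the move, so `j`
  -- inherits the bound of `m`; this is what makes copies free offline.
  Justified : ∀ {X} → Game X → Fin k → Node → ℝ → Set
  Justified S j P b = boundOf S j + d (at S j) P ≤ b
                    ⊎ (∃[ m ] m ≢ j × at S m ≡ P × boundOf S m ≤ b)

  -- The taxi at p is first sent to P, and then the taxi at slot j is called: only
  -- the configuration with its hole at j has to move the taxi from P.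
  shift : ∀ {X} (S : Game X) j P (v : X) b → Justified S j P b →
          (n : ℕ) → fresh S ℕ.≤ n → Below n P →
          ∃[ S′ ] Shifted S S′ j P v b × fresh S′ ≡ n
  shift {X} S j P v b justified n fresh≤n P<n = respond (hole S ≟ᶠ j)
    where
    σ′ = (requests S ∷ʳ (p S , P)) ∷ʳ (at S j , P)
    slot′ = slot S [ j ]≔ P

    twice : ∀ i → (slot S [ i ]≔ P) [ j ]≔ P ≡ slot′ [ i ]≔ P
    twice i with i ≟ᶠ j
    ... | yes refl = refl
    ... | no  i≢j  = []≔-commutes (slot S) i j i≢j

    at-p : ∀ i → d (lookup (slot S [ i ]≔ p S) i) (p S) ≡ 0#
    at-p i = trans (cong (λ R → d R (p S)) (lookup∘update i (slot S) (p S))) (d-refl (p S))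

    sent : ∀ i {z} → Serves root (requests S) (slot S [ i ]≔ p S) z →
           Serves root (requests S ∷ʳ (p S , P)) (slot S [ i ]≔ P) z
    sent i {z} s = Serves-resp-≡
      ([]≔-idempotent (slot S) i) (trans (cong (z +_) (at-p i)) (+-identityʳ z))
      (Serves-∷ʳ s (p S) P i)

    called : ∀ i {z} → Serves root (requests S ∷ʳ (p S , P)) (slot S [ i ]≔ P) z →
             Serves root σ′ (slot′ [ i ]≔ P) (z + d (lookup (slot S [ i ]≔ P) j) (at S j))
    called i s = Serves-resp-≡ (twice i) refl (Serves-∷ʳ s (at S j) P j)

    offline-≢ : ∀ i → i ≢ j → ∃[ z ] Serves root σ′ (slot′ [ i ]≔ P) z × z ≤ boundOf S i
    offline-≢ i i≢j with offline S i
    ... | z , s , z≤b = z , Serves-resp-≡ refl z-≡ (called i (sent i s)) , z≤b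
      where
      z-≡ : z + d (lookup (slot S [ i ]≔ P) j) (at S j) ≡ z
      z-≡ = trans (cong (λ R → z + d R (at S j)) (lookup∘update′ (i≢j ∘ sym) (slot S) P))
              (trans (cong (z +_) (d-refl (at S j))) (+-identityʳ z))

    offline-j : Justified S j P b → ∃[ z ] Serves root σ′ (slot′ [ j ]≔ P) z × z ≤ b
    offline-j (inj₂ (m , m≢j , refl , b′≤b)) with offline-≢ m m≢j
    ... | z , s , z≤b′ = z , Serves-resp-≡ same refl s , ≤-trans z≤b′ b′≤b
      where
      same : slot′ [ m ]≔ P ≡ slot′ [ j ]≔ P
      same = trans (sym ([]≔-commutes (slot S) m j m≢j))
               (trans (cong (_[ j ]≔ P) ([]≔-lookup (slot S) m)) (sym ([]≔-idempotent (slot S) j)))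
    offline-j (inj₁ b′≤b) with offline S j
    ... | z , s , z≤b = z + d P (at S j) ,
      Serves-resp-≡ refl (cong (λ R → z + d R (at S j)) (lookup∘update j (slot S) P)) (called j (sent j s)) ,
      ≤-trans (+-mono-≤ z≤b (≤-reflexive (d-sym P (at S j)))) b′≤b

    offline′ : ∀ i → ∃[ z ] Serves root σ′ (slot′ [ i ]≔ P) z × z ≤ lookup (bound S [ j ]≔ b) i
    offline′ i with i ≟ᶠ j
    ... | yes refl = let z , s , z≤b = offline-j justified in
                     z , s , ≤-trans z≤b (≤-reflexive (sym (lookup∘update j (bound S) b)))
    ... | no  i≢j  = let z , s , z≤b = offline-≢ i i≢j in
                     z , s , ≤-trans z≤b (≤-reflexive (sym (lookup∘update′ i≢j (bound S) b)))

    below′ : ∀ i → Below n (lookup slot′ i)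
    below′ i with i ≟ᶠ j
    ... | yes refl = subst (Below n) (sym (lookup∘update j (slot S) P)) P<n
    ... | no  i≢j  = subst (Below n) (sym (lookup∘update′ i≢j (slot S) P))
                       (All.map (λ m<fresh → ℕ.<-≤-trans m<fresh fresh≤n) (below S i))

    result : ∀ i x → Online A root σ′ (slot′ [ i ]≔ P) x → Game X
    result i x o = record
      { p = P ; slot = slot′ ; tag = tag S [ j ]≔ v ; bound = bound S [ j ]≔ b ; hole = i ; paid = x
      ; offline = offline′ ; simulates = o ; fresh = n ; below = below′ }

    conclude : ∀ i x o → Response S (result i x o) j P →
               ∃[ S′ ] Shifted S S′ j P v b × fresh S′ ≡ n
    conclude i x o r = result i x o ,
      record { slot-≡ = refl ; tag-≡ = refl ; bound-≡ = refl ; response = r } , refl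

    online-sent : Online A root (requests S ∷ʳ (p S , P)) (slot S [ hole S ]≔ P) (paid S)
    online-sent = Online-resp-≡ ([]≔-idempotent (slot S) (hole S))
      (Online-free A (p S) P (hole S) (lookup∘update (hole S) (slot S) (p S)) (simulates S))

    stays-put : hole S ≢ j → ∃[ S′ ] Shifted S S′ j P v b × fresh S′ ≡ n
    stays-put h≢j = conclude (hole S) (paid S)
      (Online-resp-≡ (twice (hole S))
        (Online-free A (at S j) P j (lookup∘update′ (h≢j ∘ sym) (slot S) P) online-sent))
      (elsewhere h≢j refl refl)

    moves : hole S ≡ j → ∃[ l ] Online A root σ′ ((slot S [ hole S ]≔ P) [ l ]≔ P)
                                  (paid S + d (lookup (slot S [ hole S ]≔ P) l) (at S j)) →
            ∃[ S′ ] Shifted S S′ j P v b × fresh S′ ≡ n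
    moves h≡j (l , o) = by-case (l ≟ᶠ j)
      where
      shape : (slot S [ hole S ]≔ P) [ l ]≔ P ≡ slot′ [ l ]≔ P
      shape = cong (λ i → (slot S [ i ]≔ P) [ l ]≔ P) h≡j
      o′ : Online A root σ′ (slot′ [ l ]≔ P) (paid S + d (lookup (slot S [ hole S ]≔ P) l) (at S j))
      o′ = Online-resp-≡ shape o
      lookup-≢ : l ≢ j → lookup (slot S [ hole S ]≔ P) l ≡ at S l
      lookup-≢ l≢j = lookup∘update′ (λ l≡h → l≢j (trans l≡h h≡j)) (slot S) P
      lookup-≡ : l ≡ j → lookup (slot S [ hole S ]≔ P) l ≡ P
      lookup-≡ l≡j = trans (cong (lookup (slot S [ hole S ]≔ P)) (trans l≡j (sym h≡j)))
                           (lookup∘update (hole S) (slot S) P)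
      by-case : Dec (l ≡ j) → ∃[ S′ ] Shifted S S′ j P v b × fresh S′ ≡ n
      by-case (yes l≡j) = conclude l _ o′
        (follows h≡j l≡j (cong (paid S +_)
          (trans (cong (λ R → d R (at S j)) (lookup-≡ l≡j)) (d-sym P (at S j)))))
      by-case (no l≢j) = conclude l _ o′
        (jumps h≡j l≢j refl (cong (λ R → paid S + d R (at S j)) (lookup-≢ l≢j)))

    respond : Dec (hole S ≡ j) → ∃[ S′ ] Shifted S S′ j P v b × fresh S′ ≡ n
    respond (no h≢j)  = stays-put h≢j
    respond (yes h≡j) = moves h≡j (Online-pays A (at S j) P online-sent)

  module _ {X : Set} where

    copy : (S : Game X) → ∀ j m → ∃[ S′ ] Shifted S S′ j (at S m) (tagOf S m) (boundOf S m)
    copy S j m with shift S j (at S m) (tagOf S m) (boundOf S m) justified (fresh S) ℕ.≤-refl (below S m)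
      where
      justified : Justified S j (at S m) (boundOf S m)
      justified with m ≟ᶠ j
      ... | yes refl = inj₁ (≤-reflexive (trans (cong (boundOf S j +_) (d-refl (at S j))) (+-identityʳ _)))
      ... | no  m≢j  = inj₂ (m , m≢j , refl , ≤-refl)
    ... | S′ , shifted , _ = S′ , shifted

    extend : (S : Game X) → ∀ j {w} (v : X) → 0# ≤ w →
             ∃[ S′ ] ∃[ P ] Shifted S S′ j P v (boundOf S j + w)
                          × (∀ i → d (at S i) P ≡ d (at S i) (at S j) + w)
    extend S j {w} v 0≤w with shift S j P v (boundOf S j + w)
        (inj₁ (≤-reflexive (cong (boundOf S j +_) (trans (distance j)
          (trans (cong (_+ w) (d-refl (at S j))) (+-identityˡ w))))))
        (suc (fresh S)) (ℕ.n≤1+n _) (grow-below (at S j) w (below S j))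
      where
      P = grow (at S j) (fresh S) w
      distance : ∀ i → d (at S i) P ≡ d (at S i) (at S j) + w
      distance i = d-grow (at S j) (at S i) 0≤w (below S i)
    ... | S′ , shifted , _ = S′ , _ , shifted , λ i → d-grow (at S j) (at S i) 0≤w (below S i)

    -- With all slots and `p` at the root, every choice of the hole yields the starting
    -- configuration, which explains the zero bounds.
    initial : Fin k → X → Game X
    initial i₀ v = record
      { requests = [] ; p = [] ; slot = root ; tag = Vec.replicate k v ; bound = Vec.replicate k 0#
      ; hole = i₀ ; paid = 0#
      ; offline = λ i → 0# , Serves-resp-≡ (sym (root-≡ i)) refl [] ,
                        ≤-reflexive (sym (lookup-replicate i 0#))
      ; simulates = Online-resp-≡ (sym (root-≡ i₀)) (Online-[] A)
      ; fresh = 0 ; below = λ i → subst (Below 0) (sym (lookup-replicate i [])) [] }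
      where
      root-≡ : ∀ i → root [ i ]≔ [] ≡ root
      root-≡ i = trans (cong (root [ i ]≔_) (sym (lookup-replicate i []))) ([]≔-lookup root i)

  -- Tags do not enter the requests, so a game can pass to the vertices of a larger graph in the
  -- middle of play.
  retag : ∀ {X Y : Set} → (Fin k → Y) → Game X → Game Y
  retag f S = record
    { p = p S ; slot = slot S ; tag = Vec.tabulate f ; bound = bound S ; hole = hole S ; paid = paid S
    ; offline = offline S ; simulates = simulates S ; fresh = fresh S ; below = below S }

  module _ {ρ : ℝ} (0≤ρ : 0# ≤ ρ) {c : ℝ}
           (competitive : ∀ σ → ∃[ opt ] OverReals.IsOptimalServiceCost 𝓡 tree k root σ opt
                                        × serviceCost root σ (actions A [] σ) ≤ ρ * opt + c) where

    -- The shadow pays no more than the algorithm, and the offline schedule with its hole at `i`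
    -- bounds the optimum from above; `0≤ρ` keeps that inequality under multiplication.
    paid≤ : ∀ {X} (S : Game X) i → paid S ≤ ρ * boundOf S i + c
    paid≤ S i with simulates S | offline S i | competitive (requests S)
    ... | online f lag | z , s , z≤b | opt , (_ , opt-least) , cost≤ = begin
      paid S              ≤⟨ lag⇒≤ A lag ⟩
      _                   ≡⟨ Follows⇒serviceCost A f ⟩
      _                   ≤⟨ cost≤ ⟩
      ρ * opt + c         ≤⟨ +-monoˡ-≤ c (*-monoʳ-≤ 0≤ρ (≤-trans (opt-least z (Serves⇒serviceCost s)) z≤b)) ⟩
      ρ * boundOf S i + c ∎
      where open ≤-Reasoning

  -- Offline cost is unbounded, as the first request may be arbitrarily far away.
  competitive⇒0≤ρ : Fin k → ∀ {ρ c} →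
    (∀ σ → ∃[ opt ] OverReals.IsOptimalServiceCost 𝓡 tree k root σ opt
                  × serviceCost root σ (actions A [] σ) ≤ ρ * opt + c) → 0# ≤ ρ
  competitive⇒0≤ρ i₀ {ρ} {c} competitive with ≤-total 0# ρ
  ... | inj₁ 0≤ρ = 0≤ρ
  ... | inj₂ ρ≤0 = scaled-bound⇒≤ bounded
    where
    open ≤-Reasoning
    bounded : ∀ e → 0# ≤ e → 0# * e ≤ ρ * e + c
    bounded e 0≤e with competitive (request ∷ [])
      where
      request = grow [] 0 e , grow [] 0 e
    ... | opt , ((((i , D) ∷ [] , refl)) , _) , cost≤ = begin
      0# * e      ≡⟨ zeroˡ e ⟩
      0#          ≤⟨ 0≤x+y (travelled-nonNegative root _) ≤-refl ⟩
      _           ≤⟨ cost≤ ⟩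
      ρ * opt + c ≤⟨ +-monoˡ-≤ c (*-antimonoʳ-≤ ρ≤0 e≤opt) ⟩
      ρ * e + c   ∎
      where
      P = grow [] 0 e
      e≤opt : e ≤ travelled root (D [ i ]≔ P) + 0#
      e≤opt = begin
        e                                    ≡⟨ +-identityˡ e ⟨
        0# + e                               ≡⟨ d-grow [] [] 0≤e [] ⟨
        d [] P                               ≡⟨ cong₂ d (lookup-replicate i []) (lookup∘update i D P) ⟨
        d (lookup root i) (lookup (D [ i ]≔ P) i) ≤⟨ distance≤travelled root (D [ i ]≔ P) i ⟩
        travelled root (D [ i ]≔ P)          ≤⟨ x≤x+y ≤-refl ⟩
        travelled root (D [ i ]≔ P) + 0#     ∎

-- U has n + 1 elements.
Size : ∀ {k} → ℕ → (Fin k → Set) → Set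
Size zero    U = ∀ {i j} → U i → U j → i ≡ j
Size (suc n) U = (∀ h → U h → ∃[ b ] U b × b ≢ h) × (∀ b → U b → Size n (λ i → U i × i ≢ b))

-- Removing `u j` leaves a set enumerated by `u ∘ punchIn j`, which matches the recursion of `Size`.
image-size : ∀ n {k} {U : Fin k → Set} (u : Fin (suc n) → Fin k) → (∀ {i j} → u i ≡ u j → i ≡ j) →
             (∀ i → U (u i)) → (∀ {j} → U j → ∃[ i ] u i ≡ j) → Size n U
image-size zero u u-inj u∈U U⊆u h∈U h′∈U with U⊆u h∈U | U⊆u h′∈U
... | zero , refl | zero , refl = refl
image-size (suc n) {U = U} u u-inj u∈U U⊆u = another , remove
  where
  another : ∀ h → U h → ∃[ b ] U b × b ≢ h
  another h h∈U with u zero ≟ᶠ h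
  ... | no  u₀≢h = u zero , u∈U zero , u₀≢h
  ... | yes refl = u (suc zero) , u∈U (suc zero) , λ u₁≡u₀ → Fin.0≢1+n (sym (u-inj u₁≡u₀))
  remove : ∀ b → U b → Size n (λ i → U i × i ≢ b)
  remove b b∈U with U⊆u b∈U
  ... | j , refl = image-size n (u ∘ punchIn j) (λ eq → Fin.punchIn-injective j _ _ (u-inj eq))
    (λ i → u∈U _ , λ eq → Fin.punchInᵢ≢i j i (u-inj eq))
    (λ { (i∈U , i≢uj) → let i , ui≡ = U⊆u i∈U
                            j≢i = λ j≡i → i≢uj (trans (sym ui≡) (cong u (sym j≡i)))
                        in punchOut j≢i , trans (cong u (Fin.punchIn-punchOut j≢i)) ui≡ })

-- Copying many slots at once.

module Copying (em : ExcludedMiddle 0ℓ) (𝓡 : RealNumbers) (k : ℕ)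
               (A : OverReals.OnlineTaxi 𝓡 (TreeMetric.tree em 𝓡) k) where
  open RealNumbers 𝓡
  open OrderedField em 𝓡
  open TreeMetric em 𝓡
  open SlotGame em 𝓡 k A
  open Game

  paid-mono : ∀ {X} {S S′ : Game X} {j P} → Response S S′ j P → paid S ≤ paid S′
  paid-mono (elsewhere _ _ paid≡) = ≤-reflexive (sym paid≡)
  paid-mono {S = S} {j = j} {P} (follows _ _ paid≡) = ≤-trans (x≤x+y (d-nonNegative (at S j) P)) (≤-reflexive (sym paid≡))
  paid-mono {S = S} {j = j} (jumps {l} _ _ _ paid≡) = ≤-trans (x≤x+y (d-nonNegative (at S l) (at S j))) (≤-reflexive (sym paid≡))

  SameSlot : ∀ {X} → Game X → Fin k → Game X → Fin k → Set
  SameSlot S i S′ j = at S i ≡ at S′ j × tagOf S i ≡ tagOf S′ j × boundOf S i ≡ boundOf S′ j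

  shifted-other : ∀ {X} {S S′ : Game X} {j P v b} → Shifted S S′ j P v b → ∀ {l} → l ≢ j → SameSlot S′ l S l
  shifted-other s l≢j = Shifted.at-other s l≢j , Shifted.tag-other s l≢j , Shifted.bound-other s l≢j

  SameSlot-trans : ∀ {X} {S S′ S″ : Game X} {i j l} → SameSlot S i S′ j → SameSlot S′ j S″ l → SameSlot S i S″ l
  SameSlot-trans (a , b , c) (a′ , b′ , c′) = trans a a′ , trans b b′ , trans c c′

  -- Idempotence of μ makes the sources of the copies fixed points, so the order
  -- in which the copies are made is immaterial.
  copyAll : ∀ {X} (Inv : Game X → Set) (S : Game X) (μ : Fin k → Fin k) → (∀ j → μ (μ j) ≡ μ j) →
            (∀ {T T′ j} → μ j ≢ j → Shifted T T′ j (at T (μ j)) (tagOf T (μ j)) (boundOf T (μ j)) → Inv T → Inv T′) →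
            Inv S → ∃[ S′ ] Inv S′ × (∀ l → SameSlot S′ l S (μ l))
  copyAll {X} Inv S μ μ-idem preserved inv = go (allFin k) S inv (λ l → inj₂ (∈-allFin l , refl , refl , refl))
    where
    go : ∀ js T → Inv T → (∀ l → SameSlot T l S (μ l) ⊎ (l ∈ js × SameSlot T l S l)) →
         ∃[ S′ ] Inv S′ × (∀ l → SameSlot S′ l S (μ l))
    go [] T inv-T done = T , inv-T , λ l → finished (done l)
      where
      finished : ∀ {l} → SameSlot T l S (μ l) ⊎ (l ∈ [] × SameSlot T l S l) → SameSlot T l S (μ l)
      finished (inj₁ s) = s
    go (j ∷ js) T inv-T done with μ j ≟ᶠ j
    ... | yes μj≡j = go js T inv-T λ l → skip (done l)
      where
      skip : ∀ {l} → SameSlot T l S (μ l) ⊎ (l ∈ j ∷ js × SameSlot T l S l) →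
             SameSlot T l S (μ l) ⊎ (l ∈ js × SameSlot T l S l)
      skip (inj₁ s)               = inj₁ s
      skip (inj₂ (here refl , s)) = inj₁ (subst (SameSlot T j S) (sym μj≡j) s)
      skip (inj₂ (there l∈js , s)) = inj₂ (l∈js , s)
    ... | no μj≢j with copy T j (μ j)
    ...   | T′ , shifted = go js T′ (preserved μj≢j shifted inv-T) done′
      where
      source : SameSlot T (μ j) S (μ j)
      source with done (μ j)
      ... | inj₁ s       = subst (SameSlot T (μ j) S) (μ-idem j) s
      ... | inj₂ (_ , s) = s
      copied : SameSlot T′ j T (μ j)
      copied = Shifted.at-self shifted , Shifted.tag-self shifted , Shifted.bound-self shifted
      done′ : ∀ l → SameSlot T′ l S (μ l) ⊎ (l ∈ js × SameSlot T′ l S l)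
      done′ l with l ≟ᶠ j
      ... | yes refl = inj₁ (SameSlot-trans {S = T′} {T} {S} copied source)
      ... | no l≢j with done l
      ...   | inj₁ s = inj₁ (SameSlot-trans {S = T′} {T} {S} (shifted-other shifted l≢j) s)
      ...   | inj₂ (here l≡j , s) = contradiction l≡j l≢j
      ...   | inj₂ (there l∈js , s) = inj₂ (l∈js , SameSlot-trans {S = T′} {T} {S} (shifted-other shifted l≢j) s)

-- Play confined to a set of slots.

module Adversary (em : ExcludedMiddle 0ℓ) (𝓡 : RealNumbers) (k : ℕ)
                 (A : OverReals.OnlineTaxi 𝓡 (TreeMetric.tree em 𝓡) k) where
  open RealNumbers 𝓡
  open OrderedField em 𝓡
  open TreeMetric em 𝓡
  open SlotGame em 𝓡 k A
  open Copying em 𝓡 k A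
  open Game

  -- The interface between nested games, where `P` is the common position of the slots of `U` at the
  -- start. By `far`, play inside `U` never brings these slots closer to the others. Hence a
  -- searcher that leaves `U`, however late, pays at least the initial distance to its refuge, as
  -- `escape` records.
  record Confined (U : Fin k → Set) (P : Node) (S S′ : Game ⊤) : Set where
    field
      outside : ∀ {l} → ¬ U l → SameSlot S′ l S l
      far     : ∀ {i l} → U i → ¬ U l → d P (at S l) ≤ d (at S′ i) (at S′ l)
      escape  : U (hole S′) ⊎ (¬ U (hole S′) × paid S + d P (at S (hole S′)) ≤ paid S′)
      mono    : paid S ≤ paid S′

  open Confined

  confined-refl : ∀ {U P S} → (∀ {i} → U i → at S i ≡ P) → U (hole S) → Confined U P S S
  confined-refl at≡P h∈U = record
    { outside = λ _ → refl , refl , refl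
    ; far     = λ i∈U _ → ≤-reflexive (cong (λ R → d R _) (sym (at≡P i∈U)))
    ; escape  = inj₁ h∈U
    ; mono    = ≤-refl
    }

  confined-shift : ∀ {U P S T T′ j R b} → U j → (∀ {l} → ¬ U l → d P (at S l) ≤ d R (at T l)) →
                   Shifted T T′ j R tt b → Confined U P S T → Confined U P S T′
  confined-shift {U} {P} {S} {T} {T′} {j} {R} j∈U far-R shifted c = record
    { outside = λ {l} l∉U → SameSlot-trans {S = T′} {T} {S} (shifted-other shifted (≢j l∉U)) (outside c l∉U)
    ; far     = far′
    ; escape  = escape′ response
    ; mono    = ≤-trans (mono c) (paid-mono response)
    }
    where
    open Shifted shifted
    ≢j : ∀ {l} → ¬ U l → l ≢ j
    ≢j l∉U refl = l∉U j∈U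
    far′ : ∀ {i l} → U i → ¬ U l → d P (at S l) ≤ d (at T′ i) (at T′ l)
    far′ {i} {l} i∈U l∉U with i ≟ᶠ j
    ... | yes refl = ≤-trans (far-R l∉U) (≤-reflexive (cong₂ d (sym at-self) (sym (at-other (≢j l∉U)))))
    ... | no  i≢j  = ≤-trans (far c i∈U l∉U) (≤-reflexive (cong₂ d (sym (at-other i≢j)) (sym (at-other (≢j l∉U)))))
    escape′ : Response T T′ j R → U (hole T′) ⊎ (¬ U (hole T′) × paid S + d P (at S (hole T′)) ≤ paid T′)
    escape′ (elsewhere _ hole≡ paid≡) rewrite hole≡ | paid≡ = escape c
    escape′ (follows _ hole≡ _) rewrite hole≡ = inj₁ j∈U
    escape′ (jumps {l} _ _ hole≡ paid≡) rewrite hole≡ | paid≡ with em {U l}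
    ... | yes l∈U = inj₁ l∈U
    ... | no  l∉U = inj₂ (l∉U , +-mono-≤ (mono c)
                      (≤-trans (far c j∈U l∉U) (≤-reflexive (d-sym (at T j) (at T l)))))

  -- A hole that ends outside `U` is also outside `V`, so the inner game already charges for the
  -- escape. It charges the distance from `R`, which `far-R` compares with the distance from `P`.
  confined-within : ∀ {U V P R S T T′} → (∀ {i} → V i → U i) → (∀ {l} → ¬ U l → d P (at S l) ≤ d R (at T l)) →
                    Confined U P S T → Confined V R T T′ → Confined U P S T′
  confined-within {U} {V} {P} {R} {S} {T} {T′} V⊆U far-R c c′ = record
    { outside = λ l∉U → SameSlot-trans {S = T′} {T} {S} (outside c′ (l∉U ∘ V⊆U)) (outside c l∉U)
    ; far     = far′
    ; escape  = escape′
    ; mono    = ≤-trans (mono c) (mono c′)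
    }
    where
    far′ : ∀ {i l} → U i → ¬ U l → d P (at S l) ≤ d (at T′ i) (at T′ l)
    far′ {i} {l} i∈U l∉U with em {V i}
    ... | yes i∈V = ≤-trans (far-R l∉U) (far c′ i∈V (l∉U ∘ V⊆U))
    ... | no  i∉V = ≤-trans (far c i∈U l∉U)
                      (≤-reflexive (cong₂ d (sym (proj₁ (outside c′ i∉V))) (sym (proj₁ (outside c′ (l∉U ∘ V⊆U))))))
    escape′ : U (hole T′) ⊎ (¬ U (hole T′) × paid S + d P (at S (hole T′)) ≤ paid T′)
    escape′ with em {U (hole T′)}
    ... | yes h∈U = inj₁ h∈U
    ... | no  h∉U with escape c′
    ...   | inj₁ h∈V      = contradiction (V⊆U h∈V) h∉U
    ...   | inj₂ (_ , e)  = inj₂ (h∉U , ≤-trans (+-mono-≤ (mono c) (far-R h∉U)) e)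

-- What the adversary extracts from n + 1 slots, and what it spends, when a game
-- on n + 1 slots consists of 2 M games on n slots.
module Rates (M : ℕ) where

  -- In `loss (suc n)` the summand `gain n` is half of the initial separation of the two sides, and
  -- `M ℕ.* loss n` is half of the losses of the `2 M` inner games: the cheaper side bears at most
  -- half of the total.
  gain loss : ℕ → ℕ
  gain zero    = 1
  gain (suc n) = (M ℕ.+ M) ℕ.* gain n
  loss zero    = 1
  loss (suc n) = gain n ℕ.+ M ℕ.* loss n

  -- For positive `M` this is `loss n / gain n ≤ 1/2^n + 1/M`. The recurrence halves the quotient
  -- and adds `1/(2M)`, so the first term halves and the second is reproduced.
  loss≤gain : ∀ n → 2 ℕ.^ n ℕ.* (M ℕ.* loss n) ℕ.≤ (M ℕ.+ 2 ℕ.^ n) ℕ.* gain n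
  loss≤gain zero    = begin
    1 ℕ.* (M ℕ.* 1)       ≡⟨ ℕ.*-identityˡ (M ℕ.* 1) ⟩
    M ℕ.* 1               ≤⟨ ℕ.*-monoˡ-≤ 1 (ℕ.m≤m+n M 1) ⟩
    (M ℕ.+ 1) ℕ.* 1       ∎
    where open ℕ.≤-Reasoning
  loss≤gain (suc n) = begin
    (2 ℕ.* 2ⁿ) ℕ.* (M ℕ.* (g ℕ.+ M ℕ.* l))
      ≡⟨ solve 4 (λ p m a b → (con 2 :* p) :* (m :* (a :+ m :* b))
                           := con 2 :* m :* p :* a :+ con 2 :* m :* (p :* (m :* b))) refl 2ⁿ M g l ⟩
    2 ℕ.* M ℕ.* 2ⁿ ℕ.* g ℕ.+ 2 ℕ.* M ℕ.* (2ⁿ ℕ.* (M ℕ.* l))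
      ≤⟨ ℕ.+-monoʳ-≤ (2 ℕ.* M ℕ.* 2ⁿ ℕ.* g) (ℕ.*-monoʳ-≤ (2 ℕ.* M) (loss≤gain n)) ⟩
    2 ℕ.* M ℕ.* 2ⁿ ℕ.* g ℕ.+ 2 ℕ.* M ℕ.* ((M ℕ.+ 2ⁿ) ℕ.* g)
      ≡⟨ solve 3 (λ p m a → con 2 :* m :* p :* a :+ con 2 :* m :* ((m :+ p) :* a)
                         := (m :+ con 2 :* p) :* ((m :+ m) :* a)) refl 2ⁿ M g ⟩
    (M ℕ.+ 2 ℕ.* 2ⁿ) ℕ.* ((M ℕ.+ M) ℕ.* g) ∎
    where
    open ℕ.≤-Reasoning
    open +-*-Solver
    2ⁿ = 2 ℕ.^ n
    g = gain n
    l = loss n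

  gain-positive : 1 ℕ.≤ M → ∀ n → 1 ℕ.≤ gain n
  gain-positive 1≤M zero    = ℕ.≤-refl
  gain-positive 1≤M (suc n) = ℕ.*-mono-≤ (ℕ.≤-trans 1≤M (ℕ.m≤m+n M M)) (gain-positive 1≤M n)

-- The recursive adversary.

module Forcing (em : ExcludedMiddle 0ℓ) (𝓡 : RealNumbers) (k : ℕ)
               (A : OverReals.OnlineTaxi 𝓡 (TreeMetric.tree em 𝓡) k)
               (M : ℕ) (e : RealNumbers.ℝ 𝓡) (0≤e : RealNumbers._≤_ 𝓡 (RealNumbers.0# 𝓡) e) where
  open RealNumbers 𝓡
  open OrderedField em 𝓡
  open TreeMetric em 𝓡
  open SlotGame em 𝓡 k A
  open Copying em 𝓡 k A
  open Adversary em 𝓡 k A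
  open Game
  open Confined

  open Rates M

  -- `pays` may be limited to holes in `U`, because `escape` of `confined` accounts for the others.
  -- `together` and `within` restore the hypotheses of the next game on the same slots.
  record Forced (n : ℕ) (U : Fin k → Set) (P : Node) (ω : ℝ) (S S′ : Game ⊤) : Set where
    field
      confined : Confined U P S S′
      {end}    : Node
      together : ∀ {i} → U i → at S′ i ≡ end
      within   : ∀ {i} → U i → boundOf S′ i ≤ ω + loss n · e
      pays     : U (hole S′) → paid S + gain n · e ≤ paid S′

  -- One slot b against all the others, after T rounds played on the others.
  record Rounds (U : Fin k → Set) (P : Node) (ω x z : ℝ) (S : Game ⊤) (T : ℕ) (S′ : Game ⊤) : Set where
    field
      confined  : Confined U P S S′
      {b}       : Fin k
      b∈U       : U b
      {Pa Pb}   : Node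
      {ωa ωb}   : ℝ
      at-rest   : ∀ {i} → U i → i ≢ b → at S′ i ≡ Pa
      rest≤     : ∀ {i} → U i → i ≢ b → boundOf S′ i ≤ ωa
      at-b      : at S′ b ≡ Pb
      b≤        : boundOf S′ b ≤ ωb
      bounds    : ωa + ωb ≤ (ω + ω) + (z + z) + T · x
      apart     : z ≤ d Pa Pb
      pays      : U (hole S′) → hole S′ ≢ b × paid S + T · z ≤ paid S′

  module Round {n : ℕ} {U : Fin k → Set} (size : Size (suc n) U) {P : Node} {ω : ℝ} (S : Game ⊤)
               (h∈U : U (hole S)) (at≡P : ∀ {i} → U i → at S i ≡ P) (bound≤ω : ∀ {i} → U i → boundOf S i ≤ ω)
               (force : ∀ {V R ξ T} → Size n V → V (hole T) → (∀ {i} → V i → at T i ≡ R) →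
                        (∀ {i} → V i → boundOf T i ≤ ξ) → ∃[ T′ ] Forced n V R ξ T T′) where

    x z : ℝ
    x = loss n · e
    z = gain n · e

    0≤x : 0# ≤ x
    0≤x = ·-nonNegative (loss n) 0≤e
    0≤z : 0# ≤ z
    0≤z = ·-nonNegative (gain n) 0≤e

    Rounds′ : ℕ → Game ⊤ → Set
    Rounds′ = Rounds U P ω x z S

    -- The slot pushed away is not the hole, so the searcher does not react. From then on `apart`
    -- makes an escape to `b` cost at least as much as a round inside.
    first : ∃[ S′ ] Rounds′ 0 S′
    first with proj₁ size (hole S) h∈U
    -- `apart` asks for `z`; the push by `z + z` makes half of it, the share that enters `loss`, a
    -- whole multiple of `e`.
    ... | b , b∈U , b≢h with extend S b tt (0≤x+y 0≤z 0≤z)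
    ...   | S′ , R , shifted , distance = S′ , record
      { confined = confined-shift b∈U (λ {l} _ → far-R l) shifted (confined-refl at≡P h∈U)
      ; b∈U = b∈U
      ; at-rest = λ i∈U i≢b → trans (at-other i≢b) (at≡P i∈U)
      ; rest≤ = λ i∈U i≢b → ≤-trans (≤-reflexive (bound-other i≢b)) (bound≤ω i∈U)
      ; at-b = at-self
      ; b≤ = ≤-trans (≤-reflexive bound-self) (+-monoˡ-≤ (z + z) (bound≤ω b∈U))
      ; bounds = ≤-reflexive (solve 2 (λ a c → a :+ (a :+ (c :+ c)) := ((a :+ a) :+ (c :+ c)) :+ con 0) refl ω z)
      ; apart = begin
          z                            ≤⟨ x≤x+y 0≤z ⟩
          z + z                        ≡⟨ +-identityˡ _ ⟨
          0# + (z + z)                 ≡⟨ cong (_+ (z + z)) (d-refl P) ⟨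
          d P P + (z + z)              ≡⟨ cong₂ (λ Q Q′ → d Q Q′ + (z + z)) (at≡P h∈U) (at≡P b∈U) ⟨
          d (at S (hole S)) (at S b) + (z + z) ≡⟨ distance (hole S) ⟨
          d (at S (hole S)) R          ≡⟨ cong (λ Q → d Q R) (at≡P h∈U) ⟩
          d P R                        ∎
      ; pays = λ _ → unmoved response
      }
      where
      open Shifted shifted
      open ≤-Reasoning
      far-R : ∀ l → d P (at S l) ≤ d R (at S l)
      far-R l = begin
        d P (at S l)           ≡⟨ d-sym P (at S l) ⟩
        d (at S l) P           ≡⟨ cong (d (at S l)) (at≡P b∈U) ⟨
        d (at S l) (at S b)    ≤⟨ x≤x+y (0≤x+y 0≤z 0≤z) ⟩
        d (at S l) (at S b) + (z + z) ≡⟨ distance l ⟨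
        d (at S l) R           ≡⟨ d-sym (at S l) R ⟩
        d R (at S l)           ∎
      unmoved : Response S S′ b R → hole S′ ≢ b × paid S + 0# ≤ paid S′
      unmoved (elsewhere h≢b hole≡ paid≡) =
        (λ h≡b → h≢b (trans (sym hole≡) h≡b)) , ≤-reflexive (trans (+-identityʳ _) (sym paid≡))
      unmoved (follows h≡b _ _) = contradiction (sym h≡b) b≢h
      unmoved (jumps h≡b _ _ _) = contradiction (sym h≡b) b≢h

    module _ {T : ℕ} {S₁ : Game ⊤} (r : Rounds′ T S₁) (h₁∈U : U (hole S₁)) where
      open Rounds r
      open ≤-Reasoning

      private
        V : Fin k → Set
        V i = U i × i ≢ b
        h₁∈V : V (hole S₁)
        h₁∈V = h₁∈U , proj₁ (pays h₁∈U)

      played : ∃[ S₂ ] Forced n V Pa ωa S₁ S₂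
      played = force (proj₂ size b b∈U) h₁∈V (λ i∈V → at-rest (proj₁ i∈V) (proj₂ i∈V))
                     (λ i∈V → rest≤ (proj₁ i∈V) (proj₂ i∈V))

      private
        S₂ = proj₁ played
        f  = proj₂ played

        far-Pa : ∀ {l} → ¬ U l → d P (at S l) ≤ d Pa (at S₁ l)
        far-Pa l∉U = ≤-trans (far confined h₁∈U l∉U)
          (≤-reflexive (cong (λ Q → d Q _) (at-rest h₁∈U (proj₂ h₁∈V))))

        confined₂ : Confined U P S S₂
        confined₂ = confined-within proj₁ far-Pa confined (Forced.confined f)

        b∉V : ¬ V b
        b∉V (_ , b≢b) = b≢b refl

        same-b : SameSlot S₂ b S₁ b
        same-b = outside (Forced.confined f) b∉V

        bounds₂ : (ωa + x) + ωb ≤ (ω + ω) + (z + z) + suc T · x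
        bounds₂ = begin
          (ωa + x) + ωb                       ≡⟨ solve 3 (λ p q s → (p :+ q) :+ s := q :+ (p :+ s)) refl ωa x ωb ⟩
          x + (ωa + ωb)                       ≤⟨ +-monoʳ-≤ x bounds ⟩
          x + ((ω + ω) + (z + z) + T · x)     ≡⟨ solve 3 (λ p q s → q :+ (p :+ s) := p :+ (q :+ s)) refl _ x (T · x) ⟩
          (ω + ω) + (z + z) + suc T · x       ∎

        apart₂ : z ≤ d (Forced.end f) Pb
        apart₂ = begin
          z                               ≤⟨ apart ⟩
          d Pa Pb                         ≡⟨ cong (d Pa) at-b ⟨
          d Pa (at S₁ b)                  ≤⟨ far (Forced.confined f) h₁∈V b∉V ⟩
          d (at S₂ (hole S₁)) (at S₂ b)   ≡⟨ cong₂ d (Forced.together f h₁∈V) (trans (proj₁ same-b) at-b) ⟩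
          d (Forced.end f) Pb             ∎

        accrue : ∀ {S′ : Game ⊤} → paid S₁ + z ≤ paid S′ → paid S + suc T · z ≤ paid S′
        accrue {S′} h = begin
          paid S + (z + T · z)   ≡⟨ solve 3 (λ p q s → p :+ (q :+ s) := (p :+ s) :+ q) refl (paid S) z (T · z) ⟩
          (paid S + T · z) + z   ≤⟨ +-monoˡ-≤ z (proj₂ (pays h₁∈U)) ⟩
          paid S₁ + z            ≤⟨ h ⟩
          paid S′                ∎

        stay : hole S₂ ≢ b → Rounds′ (suc T) S₂
        stay h≢b = record
          { confined = confined₂
          ; b∈U = b∈U
          ; at-rest = λ i∈U i≢b → Forced.together f (i∈U , i≢b)
          ; rest≤ = λ i∈U i≢b → Forced.within f (i∈U , i≢b)
          ; at-b = trans (proj₁ same-b) at-b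
          ; b≤ = ≤-trans (≤-reflexive (proj₂ (proj₂ same-b))) b≤
          ; bounds = bounds₂
          ; apart = apart₂
          ; pays = λ h∈U → h≢b , accrue {S₂} (Forced.pays f (h∈U , h≢b))
          }

        -- The searcher has escaped to `b`. One slot `a` remains at the end of the game just played
        -- and becomes the lone slot; the others of `U` are copied to `b`, and the two bounds change
        -- places. Only slots other than the hole are moved, so the searcher stays where it is.
        module _ (h≡b : hole S₂ ≡ b) where
          private
            other = proj₁ size b b∈U
            a = proj₁ other
            a∈U = proj₁ (proj₂ other)
            a≢b = proj₂ (proj₂ other)

            Moves : Fin k → Set
            Moves i = U i × i ≢ b × i ≢ a

            μ : Fin k → Fin k
            μ i with em {Moves i}
            ... | yes _ = b
            ... | no  _ = i

            μ-moves : ∀ {i} → Moves i → μ i ≡ b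
            μ-moves {i} m with em {Moves i}
            ... | yes _ = refl
            ... | no ¬m = contradiction m ¬m

            μ-stays : ∀ {i} → ¬ Moves i → μ i ≡ i
            μ-stays {i} ¬m with em {Moves i}
            ... | yes m = contradiction m ¬m
            ... | no  _ = refl

            μ-b : μ b ≡ b
            μ-b = μ-stays λ m → proj₁ (proj₂ m) refl

            μ-idem : ∀ i → μ (μ i) ≡ μ i
            μ-idem i with em {Moves i}
            ... | yes _ = μ-b
            ... | no ¬m = μ-stays ¬m

            Unmoved : Game ⊤ → Set
            Unmoved S′ = hole S′ ≡ b × paid S′ ≡ paid S₂ × Confined U P S S′

            unmoved : ∀ {S′ S″ j} → μ j ≢ j → Shifted S′ S″ j (at S′ (μ j)) tt (boundOf S′ (μ j)) →
                      Unmoved S′ → Unmoved S″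
            unmoved {S′} {S″} {j} μj≢j shifted (hole≡ , paid≡ , c) with em {Moves j}
            ... | no  _ = contradiction refl μj≢j
            ... | yes (j∈U , j≢b , _) with Shifted.response shifted
            ...   | elsewhere _ hole≡′ paid≡′ = trans hole≡′ hole≡ , trans paid≡′ paid≡ ,
                      confined-shift j∈U (λ l∉U → far c b∈U l∉U) shifted c
            ...   | follows h≡j _ _ = contradiction (trans (sym h≡j) hole≡) j≢b
            ...   | jumps h≡j _ _ _ = contradiction (trans (sym h≡j) hole≡) j≢b

            copied = copyAll Unmoved S₂ μ μ-idem unmoved (h≡b , refl , confined₂)
            S₃ = proj₁ copied
            hole≡b = proj₁ (proj₁ (proj₂ copied))
            paid≡ = proj₁ (proj₂ (proj₁ (proj₂ copied)))
            same = proj₂ (proj₂ copied)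

            at-b-side : ∀ {i} → U i → i ≢ a → SameSlot S₃ i S₂ b
            at-b-side {i} i∈U i≢a with i ≟ᶠ b
            ... | yes refl = subst (SameSlot S₃ b S₂) μ-b (same b)
            ... | no  i≢b  = subst (SameSlot S₃ i S₂) (μ-moves (i∈U , i≢b , i≢a)) (same i)

            same-a : SameSlot S₃ a S₂ a
            same-a = subst (SameSlot S₃ a S₂) (μ-stays λ m → proj₂ (proj₂ m) refl) (same a)

            paid-jump : paid S₁ + z ≤ paid S₃
            paid-jump with escape (Forced.confined f)
            ... | inj₁ (_ , h≢b) = contradiction h≡b h≢b
            ... | inj₂ (_ , jumped) = begin
              paid S₁ + z                       ≤⟨ +-monoʳ-≤ _ apart ⟩
              paid S₁ + d Pa Pb                 ≡⟨ cong (λ Q → paid S₁ + d Pa Q) at-b ⟨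
              paid S₁ + d Pa (at S₁ b)          ≡⟨ cong (λ i → paid S₁ + d Pa (at S₁ i)) h≡b ⟨
              paid S₁ + d Pa (at S₁ (hole S₂))  ≤⟨ jumped ⟩
              paid S₂                           ≡⟨ paid≡ ⟨
              paid S₃                           ∎

          swap : ∃[ S′ ] Rounds′ (suc T) S′
          swap = S₃ , record
            { confined = proj₂ (proj₂ (proj₁ (proj₂ copied)))
            ; b∈U = a∈U
            ; at-rest = λ i∈U i≢a → trans (proj₁ (at-b-side i∈U i≢a)) (trans (proj₁ same-b) at-b)
            ; rest≤ = λ i∈U i≢a → ≤-trans
                (≤-reflexive (trans (proj₂ (proj₂ (at-b-side i∈U i≢a))) (proj₂ (proj₂ same-b)))) b≤
            ; at-b = trans (proj₁ same-a) (Forced.together f (a∈U , a≢b))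
            ; b≤ = ≤-trans (≤-reflexive (proj₂ (proj₂ same-a))) (Forced.within f (a∈U , a≢b))
            ; bounds = ≤-trans (≤-reflexive (+-comm ωb (ωa + x))) bounds₂
            ; apart = ≤-trans apart₂ (≤-reflexive (d-sym (Forced.end f) Pb))
            ; pays = λ _ → (λ h≡a → a≢b (trans (sym h≡a) hole≡b)) , accrue {S₃} paid-jump
            }

      continue : ∃[ S′ ] Rounds′ (suc T) S′
      continue with hole S₂ ≟ᶠ b
      ... | yes h≡b = swap h≡b
      ... | no  h≢b = S₂ , stay h≢b

    next : ∀ {T} → ∃[ S₁ ] Rounds′ T S₁ → ∃[ S′ ] Rounds′ (suc T) S′
    next {T} (S₁ , r) with em {U (hole S₁)}
    ... | yes h∈U = continue r h∈U
    -- After an escape from `U` nothing more is played: `pays` is vacuous, and `bounds` only becomes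
    -- weaker as the counter grows.
    ... | no  h∉U = S₁ , record
      { confined = confined ; b∈U = b∈U ; at-rest = at-rest ; rest≤ = rest≤ ; at-b = at-b ; b≤ = b≤
      ; bounds = ≤-trans bounds (+-monoʳ-≤ _ (y≤x+y 0≤x)) ; apart = apart
      ; pays = λ h∈U → contradiction h∈U h∉U }
      where open Rounds r

    rounds : ∀ T → ∃[ S′ ] Rounds′ T S′
    rounds zero    = first
    rounds (suc T) = next (rounds T)

    private
      last-round = rounds (M ℕ.+ M)
      S₁ = proj₁ last-round
      open Rounds (proj₂ last-round)
      open ≤-Reasoning

    cheap : ∃[ m ] U m × boundOf S₁ m ≤ ω + loss (suc n) · e
    cheap = choose (≤-total ωa ωb)
      where
      total≤ : ωa + ωb ≤ (ω + loss (suc n) · e) + (ω + loss (suc n) · e)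
      total≤ = begin
        ωa + ωb                                  ≤⟨ bounds ⟩
        (ω + ω) + (z + z) + (M ℕ.+ M) · x        ≡⟨ cong ((ω + ω) + (z + z) +_) (·-homo-+ x M M) ⟩
        (ω + ω) + (z + z) + (M · x + M · x)      ≡⟨ solve 3 (λ p q s → ((p :+ p) :+ (q :+ q)) :+ (s :+ s) := (p :+ (q :+ s)) :+ (p :+ (q :+ s))) refl ω z (M · x) ⟩
        (ω + (z + M · x)) + (ω + (z + M · x))    ≡⟨ cong (λ u → (ω + u) + (ω + u)) loss-≡ ⟨
        (ω + loss (suc n) · e) + (ω + loss (suc n) · e) ∎
        where
        loss-≡ : loss (suc n) · e ≡ z + M · x
        loss-≡ = trans (·-homo-+ e (gain n) (M ℕ.* loss n)) (cong (z +_) (sym (·-assocˡ e M (loss n))))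
      other = proj₁ size b b∈U
      choose : ωa ≤ ωb ⊎ ωb ≤ ωa → ∃[ m ] U m × boundOf S₁ m ≤ ω + loss (suc n) · e
      choose (inj₁ ωa≤ωb) = proj₁ other , proj₁ (proj₂ other) ,
        ≤-trans (rest≤ (proj₁ (proj₂ other)) (proj₂ (proj₂ other)))
          (x+x≤y+y⇒x≤y (≤-trans (+-monoʳ-≤ ωa ωa≤ωb) total≤))
      choose (inj₂ ωb≤ωa) = b , b∈U ,
        ≤-trans b≤ (x+x≤y+y⇒x≤y (≤-trans (+-monoˡ-≤ ωb ωb≤ωa) total≤))

    private
      m = proj₁ cheap
      m∈U = proj₁ (proj₂ cheap)

      μ : Fin k → Fin k
      μ i with em {U i}
      ... | yes _ = m
      ... | no  _ = i

      μ-inside : ∀ {i} → U i → μ i ≡ m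
      μ-inside {i} i∈U with em {U i}
      ... | yes _  = refl
      ... | no i∉U = contradiction i∈U i∉U

      μ-idem : ∀ i → μ (μ i) ≡ μ i
      μ-idem i with em {U i}
      ... | yes _ = μ-inside m∈U
      ... | no i∉U with em {U i}
      ...   | yes i∈U = contradiction i∈U i∉U
      ...   | no  _   = refl

      -- Gathering the slots at the cheapest one may drive the searcher out of `U`, but a hole
      -- outside `U` is not affected by moves inside. So a hole that ends in `U` was there after the
      -- last round, and `pays` of that round applies.
      Collapsing : Game ⊤ → Set
      Collapsing S′ = Confined U P S S′ × paid S₁ ≤ paid S′ × (U (hole S′) → U (hole S₁))

      collapsing : ∀ {S′ S″ j} → μ j ≢ j → Shifted S′ S″ j (at S′ (μ j)) tt (boundOf S′ (μ j)) →
                   Collapsing S′ → Collapsing S″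
      collapsing {S′} {S″} {j} μj≢j shifted (c , paid≤ , inside) with em {U j}
      ... | no  _   = contradiction refl μj≢j
      ... | yes j∈U = confined-shift j∈U (λ l∉U → far c m∈U l∉U) shifted c ,
                      ≤-trans paid≤ (paid-mono (Shifted.response shifted)) ,
                      inside′ (Shifted.response shifted)
        where
        inside′ : Response S′ S″ j (at S′ m) → U (hole S″) → U (hole S₁)
        inside′ (elsewhere _ hole≡ _) h∈U = inside (subst U hole≡ h∈U)
        inside′ (follows h≡j _ _)     _   = inside (subst U (sym h≡j) j∈U)
        inside′ (jumps h≡j _ _ _)     _   = inside (subst U (sym h≡j) j∈U)

    collapsed : ∃[ S′ ] Forced (suc n) U P ω S S′
    collapsed with copyAll Collapsing S₁ μ μ-idem collapsing (confined , ≤-refl , λ h∈U → h∈U)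
    ... | S′ , (c , paid≤ , inside) , same = S′ , record
      { confined = c
      ; together = λ {i} i∈U → trans (proj₁ (same i)) (cong (at S₁) (μ-inside i∈U))
      ; within   = λ {i} i∈U → ≤-trans
          (≤-reflexive (trans (proj₂ (proj₂ (same i))) (cong (boundOf S₁) (μ-inside i∈U))))
          (proj₂ (proj₂ cheap))
      ; pays     = λ h∈U → begin
          paid S + gain (suc n) · e  ≡⟨ cong (paid S +_) (·-assocˡ e (M ℕ.+ M) (gain n)) ⟨
          paid S + (M ℕ.+ M) · z     ≤⟨ proj₂ (pays (inside h∈U)) ⟩
          paid S₁                    ≤⟨ paid≤ ⟩
          paid S′                    ∎
      }

  -- When the single slot of `U` is pushed away, a hole in it has to follow for `e` or jump, and a
  -- jump ends outside `U`. More slots are handled by the rounds.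
  force : ∀ n {U P ω S} → Size n U → U (hole S) → (∀ {i} → U i → at S i ≡ P) →
          (∀ {i} → U i → boundOf S i ≤ ω) → ∃[ S′ ] Forced n U P ω S S′
  force zero {U} {P} {ω} {S} size h∈U at≡P bound≤ω with extend S (hole S) tt 0≤e
  ... | S′ , R , shifted , distance = S′ , record
    { confined = confined-shift h∈U (λ {l} _ → far-R l) shifted (confined-refl at≡P h∈U)
    ; together = λ i∈U → subst (λ i → at S′ i ≡ R) (size h∈U i∈U) at-self
    ; within   = λ i∈U → subst (λ i → boundOf S′ i ≤ ω + 1 · e) (size h∈U i∈U) (begin
        boundOf S′ (hole S)    ≡⟨ bound-self ⟩
        boundOf S (hole S) + e ≤⟨ +-mono-≤ (bound≤ω h∈U) (x≤x+y ≤-refl) ⟩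
        ω + 1 · e              ∎)
    ; pays     = moved response
    }
    where
    open Shifted shifted
    open ≤-Reasoning
    far-R : ∀ l → d P (at S l) ≤ d R (at S l)
    far-R l = begin
      d P (at S l)               ≡⟨ d-sym P (at S l) ⟩
      d (at S l) P               ≡⟨ cong (d (at S l)) (at≡P h∈U) ⟨
      d (at S l) (at S (hole S)) ≤⟨ x≤x+y 0≤e ⟩
      d (at S l) (at S (hole S)) + e ≡⟨ distance l ⟨
      d (at S l) R               ≡⟨ d-sym (at S l) R ⟩
      d R (at S l)               ∎
    moved : Response S S′ (hole S) R → U (hole S′) → paid S + 1 · e ≤ paid S′
    moved (elsewhere h≢h _ _) _ = contradiction refl h≢h
    moved (follows _ _ paid≡) _ = begin
      paid S + (e + 0#)                              ≡⟨ cong (paid S +_) (trans (+-identityʳ e) (sym (+-identityˡ e))) ⟩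
      paid S + (0# + e)                              ≡⟨ cong (λ u → paid S + (u + e)) (d-refl (at S (hole S))) ⟨
      paid S + (d (at S (hole S)) (at S (hole S)) + e) ≡⟨ cong (paid S +_) (distance (hole S)) ⟨
      paid S + d (at S (hole S)) R                   ≡⟨ paid≡ ⟨
      paid S′                                        ∎
    moved (jumps {l} _ l≢h hole≡ _) h∈U′ = contradiction (size (subst U hole≡ h∈U′) h∈U) l≢h
  force (suc n) {S = S} size h∈U at≡P bound≤ω = Round.collapsed size S h∈U at≡P bound≤ω (force n)

-- The exponential lower bound on the ratio.

module LowerBound (em : ExcludedMiddle 0ℓ) (𝓡 : RealNumbers) where
  open RealNumbers 𝓡
  open OverReals 𝓡 using (TaxiCompetitive)
  open OrderedField em 𝓡
  open TreeMetric em 𝓡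

  2^·1≡2#^ : ∀ n → (2 ℕ.^ n) · 1# ≡ 2# ^ n
  2^·1≡2#^ zero    = +-identityʳ 1#
  2^·1≡2#^ (suc n) = begin
    (2 ℕ.* 2 ℕ.^ n) · 1#   ≡⟨ ·-assocˡ 1# 2 (2 ℕ.^ n) ⟨
    2 · ((2 ℕ.^ n) · 1#)   ≡⟨ cong (2 ·_) (2^·1≡2#^ n) ⟩
    2 · (2# ^ n)           ≡⟨ solve 1 (λ x → x :+ (x :+ con 0) := (con 2) :* x) refl (2# ^ n) ⟩
    2# * 2# ^ n            ∎
    where open ≡-Reasoning

  ·-≡-* : ∀ n x → n · x ≡ (n · 1#) * x
  ·-≡-* n x = trans (cong (n ·_) (sym (*-identityˡ x))) (sym (·-assoc-* n 1# x))

  module _ (k : ℕ) (A : OverReals.OnlineTaxi 𝓡 tree (suc k)) where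
    private
      -- This makes the error `1/M` of `loss≤gain` equal to the main term `1/2^k`, at the price of a
      -- factor of two.
      M = 2 ℕ.^ k
    open SlotGame em 𝓡 (suc k) A
    open Game

    open Rates M

    M*loss≤2*gain : M ℕ.* loss k ℕ.≤ gain k ℕ.+ gain k
    M*loss≤2*gain = ℕ.*-cancelˡ-≤ M {{ℕ.m^n≢0 2 k}} (begin
      M ℕ.* (M ℕ.* loss k)      ≤⟨ loss≤gain k ⟩
      (M ℕ.+ M) ℕ.* gain k      ≡⟨ ℕ.*-distribʳ-+ (gain k) M M ⟩
      M ℕ.* gain k ℕ.+ M ℕ.* gain k ≡⟨ ℕ.*-distribˡ-+ M (gain k) (gain k) ⟨
      M ℕ.* (gain k ℕ.+ gain k) ∎)
      where open ℕ.≤-Reasoning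

    module _ {ρ c : ℝ} (competitive : ∀ σ → ∃[ opt ] OverReals.IsOptimalServiceCost 𝓡 tree (suc k) root σ opt
                 × LazySimulation.serviceCost em 𝓡 tree (suc k) root σ (LazySimulation.actions em 𝓡 tree (suc k) A [] σ) ≤ ρ * opt + c) where
      open ≤-Reasoning

      0≤ρ : 0# ≤ ρ
      0≤ρ = competitive⇒0≤ρ zero competitive

      -- With all slots in `U` there is nowhere to escape, so `pays` applies without condition. The
      -- unit length `e` stays free so that the constant `c` can be scaled away.
      forced : ∀ e → 0# ≤ e → gain k · e ≤ ρ * (loss k · e) + c
      forced e 0≤e with Forcing.force em 𝓡 (suc k) A M e 0≤e k {U = λ _ → ⊤} {P = []} {ω = 0#} {S = initial zero tt}
                          (image-size k (λ i → i) (λ eq → eq) _ (λ {j} _ → j , refl)) tt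
                          (λ {i} _ → lookup-replicate i []) (λ {i} _ → ≤-reflexive (lookup-replicate i 0#))
      ... | S , f = begin
        gain k · e                     ≡⟨ +-identityˡ _ ⟨
        0# + gain k · e                ≤⟨ Forcing.Forced.pays f tt ⟩
        paid S                         ≤⟨ paid≤ 0≤ρ competitive S zero ⟩
        ρ * boundOf S zero + c         ≤⟨ +-monoˡ-≤ c (*-monoʳ-≤ 0≤ρ (Forcing.Forced.within f tt)) ⟩
        ρ * (0# + loss k · e) + c      ≡⟨ cong (λ u → ρ * u + c) (+-identityˡ _) ⟩
        ρ * (loss k · e) + c           ∎

      G = gain k · 1#

      scaled : ∀ e → 0# ≤ e → (2# ^ k * G) * e ≤ ((ρ + ρ) * G) * e + M · c
      scaled e 0≤e = begin
        (2# ^ k * G) * e                 ≡⟨ *-assoc _ G e ⟩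
        2# ^ k * (G * e)                 ≡⟨ cong₂ _*_ (2^·1≡2#^ k) (·-≡-* (gain k) e) ⟨
        (M · 1#) * (gain k · e)          ≤⟨ *-monoʳ-≤ (·-nonNegative M 0≤1) (forced e 0≤e) ⟩
        (M · 1#) * (ρ * (loss k · e) + c)   ≡⟨ solve 4 (λ m r l c → m :* (r :* l :+ c) := r :* (m :* l) :+ m :* c) refl (M · 1#) ρ (loss k · e) c ⟩
        ρ * ((M · 1#) * (loss k · e)) + (M · 1#) * c ≡⟨ cong₂ (λ u v → ρ * u + v) (·-≡-* M (loss k · e)) (·-≡-* M c) ⟨
        ρ * (M · (loss k · e)) + M · c   ≡⟨ cong (λ u → ρ * u + M · c) (·-assocˡ e M (loss k)) ⟩
        ρ * ((M ℕ.* loss k) · e) + M · c ≤⟨ +-monoˡ-≤ (M · c) (*-monoʳ-≤ 0≤ρ (·-monoˡ-≤ 0≤e M*loss≤2*gain)) ⟩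
        ρ * ((gain k ℕ.+ gain k) · e) + M · c ≡⟨ cong (λ u → ρ * u + M · c) (·-homo-+ e (gain k) (gain k)) ⟩
        ρ * (gain k · e + gain k · e) + M · c ≡⟨ cong (λ u → ρ * (u + u) + M · c) (·-≡-* (gain k) e) ⟩
        ρ * (G * e + G * e) + M · c      ≡⟨ cong (_+ M · c) (solve 3 (λ r g e → r :* (g :* e :+ g :* e) := ((r :+ r) :* g) :* e) refl ρ G e) ⟩
        ((ρ + ρ) * G) * e + M · c        ∎

      2^k≤2ρ : 2# ^ k ≤ ρ + ρ
      2^k≤2ρ = *-cancelʳ-≤ 0<G (scaled-bound⇒≤ scaled)
        where
        0<G : 0# < G
        0<G = ≤-trans 0≤1 1≤G , λ 0≡G → 0≢1 (≤-antisym 0≤1 (≤-trans 1≤G (≤-reflexive (sym 0≡G))))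
          where
          1≤G : 1# ≤ G
          1≤G = ≤-trans (≤-reflexive (sym (+-identityʳ 1#))) (·-monoˡ-≤ 0≤1 (gain-positive (ℕ.m^n>0 2 k) k))

  0≤2 : 0# ≤ 2#
  0≤2 = 0≤x+y 0≤1 0≤1

  -- The constant of the lower bound: one factor of two is lost to the choice of `M`, the other
  -- because `suc k` taxis force only a power with exponent `k`.
  quarter : ∃[ c ] 0# < c × (2# * 2#) * c ≡ 1#
  quarter = positive-inverse (subst (0# <_) 2+2≡2*2 (0<x+y (0<x+y 0<1 0≤1) 0≤2))
    where
    2+2≡2*2 : 2# + 2# ≡ 2# * 2#
    2+2≡2*2 = sym (trans (distribʳ 2# 1# 1#) (cong₂ _+_ (*-identityˡ 2#) (*-identityˡ 2#)))

  TaxiCompetitive⇒2^k≤4ρ : ∀ k {ρ} → TaxiCompetitive (suc k) ρ → proj₁ quarter * 2# ^ suc k ≤ ρ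
  TaxiCompetitive⇒2^k≤4ρ k {ρ} taxi with taxi tree (Vec.replicate (suc k) [])
  ... | A , c , competitive = begin
    q * (2# * 2# ^ k)   ≤⟨ *-monoʳ-≤ (proj₁ (proj₁ (proj₂ quarter))) (*-monoʳ-≤ 0≤2 (2^k≤2ρ k A competitive)) ⟩
    q * (2# * (ρ + ρ))  ≡⟨ solve 2 (λ q r → q :* (con 2 :* (r :+ r)) := ((con 2 :* con 2) :* q) :* r) refl q ρ ⟩
    ((2# * 2#) * q) * ρ ≡⟨ cong (_* ρ) (proj₂ (proj₂ quarter)) ⟩
    1# * ρ              ≡⟨ *-identityˡ ρ ⟩
    ρ                   ∎
    where
    open ≤-Reasoning
    q = proj₁ quarter

-- Infima of large sets of reals.

module Infima (em : ExcludedMiddle (lsuc 0ℓ)) (𝓡 : RealNumbers) where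
  open RealNumbers 𝓡
  open OverReals 𝓡 using (IsInfimum; ℝ±)
  open IsTotalOrder isTotalOrder using () renaming (trans to ≤-trans)
  open AddExtrema _≤_ using (⊥±≤_; _≤⊤±; [≤]-injective; _≤±_) renaming ([_] to [_]≤)

  -- The supremum axiom only speaks of predicates in Set; excluded middle makes
  -- the predicate of being a lower bound small.
  infimum : (S : Pred ℝ (lsuc 0ℓ)) → (∃[ b ] ∀ x → S x → b ≤ x) → ∃[ r ] IsInfimum S r
  infimum S (b₀ , b₀≤) with em {∃ S}
  ... | no  empty = ⊤± , (λ x x∈S → contradiction (x , x∈S) empty) , λ b _ → b ≤⊤±
  ... | yes (x₀ , x₀∈S) = [ u ] , (λ x x∈S → [ u-least x (below x∈S) ]≤) , greatest
    where
    LowerBound : Pred ℝ 0ℓ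
    LowerBound b = True (em {∀ x → S x → b ≤ x})
    below : ∀ {x} → S x → ∀ b → LowerBound b → b ≤ x
    below x∈S b b-lower = toWitness b-lower _ x∈S
    sup = supremum LowerBound (b₀ , fromWitness b₀≤) (x₀ , below x₀∈S)
    u = proj₁ sup
    u-upper = proj₁ (proj₂ sup)
    u-least = proj₂ (proj₂ sup)
    greatest : ∀ b → (∀ x → S x → b ≤± [ x ]) → b ≤± [ u ]
    greatest ⊥±    _     = ⊥±≤ [ u ]
    greatest [ b ] b≤    = [ u-upper b (fromWitness λ x x∈S → [≤]-injective (b≤ x x∈S)) ]≤
    greatest ⊤±    ⊤≤    with ⊤≤ x₀ x₀∈S
    ... | ()

-- Distributing the vertices of a new layer over the slots.

-- `F j` is the child that slot `j` will represent. The last component makes `f ∘ F` idempotent,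
-- which is the condition under which `copyAll` may copy slot `f (F j)` to slot `j`.
Placement : ∀ {b k} → (Fin b → Fin k) → Set
Placement {b} {k} f =
  ∃ λ (F : Fin k → Fin b) → (∀ u → ∃[ j ] F j ≡ u) × (∀ j → f (F j) ≡ j ⊎ (∀ u → f u ≢ j))

-- The child u is to be placed in slot f u or in a copy of it.  A slot that some
-- child needs as a source is not overwritten: it receives one of its own children.
placement : ∀ {b k} (f : Fin (suc b) → Fin k) → suc b ℕ.≤ k → Placement f
placement {zero} {k} f _ = (λ _ → zero) , (λ { zero → f zero , refl }) , own
  where
  own : ∀ j → f zero ≡ j ⊎ (∀ u → f u ≢ j)
  own j with f zero ≟ᶠ j
  ... | yes f₀≡j = inj₁ f₀≡j
  ... | no  f₀≢j = inj₂ λ { zero → f₀≢j }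
placement {suc b} {k} f b<k with placement (f ∘ suc) (ℕ.≤-trans (ℕ.n≤1+n _) b<k)
... | F , onto , own = extend spare
  where
  -- Two slots share a child, and one of them is not the child's own slot.
  spare : ∃[ j ] (∃[ i ] i ≢ j × F i ≡ F j) × (∀ u → f (suc u) ≢ j)
  spare with Fin.pigeonhole b<k F
  ... | i , j , i<j , Fi≡Fj with own i | own j
  ...   | _        | inj₂ free = j , (i , Fin.<⇒≢ i<j , Fi≡Fj) , free
  ...   | inj₂ free | inj₁ _   = i , (j , Fin.<⇒≢ i<j ∘ sym , sym Fi≡Fj) , free
  ...   | inj₁ fi   | inj₁ fj  =
    contradiction (trans (sym fi) (trans (cong (f ∘ suc) Fi≡Fj) fj)) (Fin.<⇒≢ i<j)

  c = f zero

  extend : (∃[ j ] (∃[ i ] i ≢ j × F i ≡ F j) × (∀ u → f (suc u) ≢ j)) → Placement f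
  extend (j , (i , i≢j , Fi≡Fj) , free) = by-case (Fin.any? λ u → f (suc u) ≟ᶠ c)
    where
    by-case : Dec (∃[ u ] f (suc u) ≡ c) → Placement f
    -- Slot `c` keeps the child it already has, which also starts from there, and the new child gets
    -- the spare slot.
    by-case (yes (u₀ , fu₀≡c)) = F′ , onto′ , own′
      where
      F′ : Fin k → Fin (suc (suc b))
      F′ l with l ≟ᶠ j
      ... | yes _ = zero
      ... | no  _ = suc (F l)
      F′-other : ∀ {l} → l ≢ j → F′ l ≡ suc (F l)
      F′-other {l} l≢j with l ≟ᶠ j
      ... | yes l≡j = contradiction l≡j l≢j
      ... | no  _   = refl
      onto′ : ∀ u → ∃[ l ] F′ l ≡ u
      onto′ zero = j , F′j≡0
        where
        F′j≡0 : F′ j ≡ zero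
        F′j≡0 with j ≟ᶠ j
        ... | yes _   = refl
        ... | no  j≢j = contradiction refl j≢j
      onto′ (suc u) with onto u
      ... | l , Fl≡u with l ≟ᶠ j
      ...   | yes l≡j = i , trans (F′-other i≢j) (cong suc (trans Fi≡Fj (trans (cong F (sym l≡j)) Fl≡u)))
      ...   | no  l≢j  = l , trans (F′-other l≢j) (cong suc Fl≡u)
      own′ : ∀ l → f (F′ l) ≡ l ⊎ (∀ u → f u ≢ l)
      own′ l with l ≟ᶠ j
      ... | yes refl = inj₂ λ { zero c≡j → free u₀ (trans fu₀≡c c≡j) ; (suc u) → free u }
      ... | no  _ with own l
      ...   | inj₁ fFl≡l  = inj₁ fFl≡l
      ...   | inj₂ free-l = inj₂ λ { zero c≡l → free-l u₀ (trans fu₀≡c c≡l) ; (suc u) → free-l u }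
    -- No earlier child starts from `c`, so `c` can take the new child; the child that it held moves
    -- to the spare slot.
    by-case (no ∄u) = F′ , onto′ , own′
      where
      F′ : Fin k → Fin (suc (suc b))
      F′ l with l ≟ᶠ c
      ... | yes _ = zero
      ... | no  _ with l ≟ᶠ j
      ...   | yes _ = suc (F c)
      ...   | no  _ = suc (F l)
      F′-c : F′ c ≡ zero
      F′-c with c ≟ᶠ c
      ... | yes _   = refl
      ... | no  c≢c = contradiction refl c≢c
      F′-j : j ≢ c → F′ j ≡ suc (F c)
      F′-j j≢c with j ≟ᶠ c
      ... | yes j≡c = contradiction j≡c j≢c
      ... | no  _ with j ≟ᶠ j
      ...   | yes _   = refl
      ...   | no  j≢j = contradiction refl j≢j
      F′-other : ∀ {l} → l ≢ c → l ≢ j → F′ l ≡ suc (F l)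
      F′-other {l} l≢c l≢j with l ≟ᶠ c
      ... | yes l≡c = contradiction l≡c l≢c
      ... | no  _ with l ≟ᶠ j
      ...   | yes l≡j = contradiction l≡j l≢j
      ...   | no  _   = refl
      spared : ∀ {l} → l ≢ j → ∃[ l′ ] F′ l′ ≡ suc (F l)
      spared {l} l≢j with l ≟ᶠ c
      ... | no l≢c = l , F′-other l≢c l≢j
      ... | yes refl = j , F′-j (l≢j ∘ sym)
      onto′ : ∀ u → ∃[ l ] F′ l ≡ u
      onto′ zero = c , F′-c
      onto′ (suc u) with onto u
      ... | l , refl with l ≟ᶠ j
      ...   | yes refl = let l′ , eq = spared i≢j in l′ , trans eq (cong suc Fi≡Fj)
      ...   | no  l≢j  = spared l≢j
      own′ : ∀ l → f (F′ l) ≡ l ⊎ (∀ u → f u ≢ l)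
      own′ l with l ≟ᶠ c
      ... | yes refl = inj₁ refl
      ... | no  l≢c with l ≟ᶠ j
      ...   | yes refl = inj₂ λ { zero c≡l → l≢c (sym c≡l) ; (suc u) → free u }
      ...   | no  _ with own l
      ...     | inj₁ fFl≡l  = inj₁ fFl≡l
      ...     | inj₂ free-l = inj₂ λ { zero c≡l → l≢c (sym c≡l) ; (suc u) → free-l u }

-- Walks and the existence of shortest walks.

module Walks (em : ExcludedMiddle 0ℓ) (𝓡 : RealNumbers) where
  open RealNumbers 𝓡
  open OverReals 𝓡
  open OrderedField em 𝓡
  open ≤-Reasoning

  private variable
    a b : ℕ
    G : LayeredGraph a
    E : Edges a b
    u v x : Vertex G
    w w′ r s : ℝ

  infixr 5 _++ʷ_
  _++ʷ_ : Walk G u v → Walk G v x → Walk G u x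
  []           ++ʷ q = q
  forward e p  ++ʷ q = forward e (p ++ʷ q)
  backward e p ++ʷ q = backward e (p ++ʷ q)

  length-++ : (p : Walk G u v) (q : Walk G v x) → walkLength (p ++ʷ q) ≡ walkLength p + walkLength q
  length-++ []             q = sym (+-identityˡ _)
  length-++ (forward e p)  q = trans (cong (_ +_) (length-++ p q)) (sym (+-assoc _ _ _))
  length-++ (backward e p) q = trans (cong (_ +_) (length-++ p q)) (sym (+-assoc _ _ _))

  reverse : Walk G u v → Walk G v u
  reverse []             = []
  reverse (forward e p)  = reverse p ++ʷ backward e []
  reverse (backward e p) = reverse p ++ʷ forward e []

  length-reverse : (p : Walk G u v) → walkLength (reverse p) ≡ walkLength p
  length-reverse []             = refl
  length-reverse (forward e p)  = trans (length-++ (reverse p) _)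
    (trans (cong₂ _+_ (length-reverse p) (+-identityʳ _)) (+-comm _ _))
  length-reverse (backward e p) = trans (length-++ (reverse p) _)
    (trans (cong₂ _+_ (length-reverse p) (+-identityʳ _)) (+-comm _ _))

  relocate : ∀ {a} {G : LayeredGraph a} {u u′ v v′ : Vertex G} → u ≡ u′ → v ≡ v′ → (p : Walk G u v) →
             ∃[ p′ ] walkLength {G = G} {u′} {v′} p′ ≡ walkLength p
  relocate refl refl p = p , refl

  olderʷ : Walk G u v → Walk (G ▷ E) (older u) (older v)
  olderʷ []             = []
  olderʷ (forward e p)  = forward (older e) (olderʷ p)
  olderʷ (backward e p) = backward (older e) (olderʷ p)

  length-older : (p : Walk G u v) → walkLength (olderʷ {E = E} p) ≡ walkLength p
  length-older []             = refl
  length-older (forward e p)  = cong (_ +_) (length-older p)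
  length-older (backward e p) = cong (_ +_) (length-older p)

  length-nonNegative : NonNegativeWeights G → (p : Walk G u v) → 0# ≤ walkLength p
  length-nonNegative nn []             = ≤-refl
  length-nonNegative nn (forward e p)  = 0≤x+y (nn e) (length-nonNegative nn p)
  length-nonNegative nn (backward e p) = 0≤x+y (nn e) (length-nonNegative nn p)

  -- A walk into the new layer is cut where it first reaches the layer before.
  first-visit : ∀ {G : LayeredGraph a} {E : Edges a b} {u j} (p : Walk (G ▷ E) (older u) (last j)) →
    ∃[ v ] ∃[ q ] ∃[ r ] walkLength {G = G} {u} {last v} q + walkLength {G = G ▷ E} {older (last v)} {last j} r
                       ≡ walkLength p
  first-visit p@(forward (last {i = i} _) _) = i , [] , p , +-identityˡ _
  first-visit (forward (older e) p) with first-visit p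
  ... | v , q , r , eq = v , forward e q , r , trans (+-assoc _ _ _) (cong (_ +_) eq)
  first-visit (backward (older e) p) with first-visit p
  ... | v , q , r , eq = v , backward e q , r , trans (+-assoc _ _ _) (cong (_ +_) eq)

  vertices : (G : LayeredGraph a) → List (Vertex G)
  vertices start         = map last (allFin 1)
  vertices (_▷_ {b = b} G E) = map last (allFin b) ++ map older (vertices G)

  ∈-vertices : {G : LayeredGraph a} (v : Vertex G) → v ∈ vertices G
  ∈-vertices {G = start}  (last i)  = ∈-map⁺ last (∈-allFin i)
  ∈-vertices {G = G ▷ E} (last i)  = ∈-++⁺ˡ (∈-map⁺ last (∈-allFin i))
  ∈-vertices {G = G ▷ E} (older v) = ∈-++⁺ʳ (map last (allFin _)) (∈-map⁺ older (∈-vertices v))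

  Edge-unique : Edge G u v w → Edge G u v w′ → w ≡ w′
  Edge-unique (last e)  (last e′)  = just-injective (trans (sym e) e′)
  Edge-unique (older e) (older e′) = Edge-unique e e′

  Adjacent : (G : LayeredGraph a) → Vertex G → Vertex G → ℝ → Set
  Adjacent G u v w = Edge G u v w ⊎ Edge G v u w

  -- Shortest walks are found as in the Floyd–Warshall algorithm, by admitting one
  -- interior vertex at a time.
  data Via {a} (G : LayeredGraph a) (L : List (Vertex G)) : Vertex G → Vertex G → ℝ → Set where
    edge : ∀ {u v w} → Adjacent G u v w → Via G L u v w
    step : ∀ {u v x w r} → Adjacent G u v w → v ∈ L → Via G L v x r → Via G L u x (w + r)

  -- Minima are assumed only for nonempty sets, since either kind of walk may be absent between two
  -- given vertices.
  minimum-⊎ : {S T : ℝ → Set} → (∃ S → ∃ (IsMinimum S)) → (∃ T → ∃ (IsMinimum T)) →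
              ∃ (λ x → S x ⊎ T x) → ∃ (IsMinimum (λ x → S x ⊎ T x))
  minimum-⊎ {S} {T} minS minT (x , x∈) with em {∃ S} | em {∃ T}
  ... | no ∄S | no ∄T = contradiction x∈ λ { (inj₁ s) → ∄S (x , s) ; (inj₂ t) → ∄T (x , t) }
  ... | yes s | no ∄T = let m , m∈S , least = minS s in
    m , inj₁ m∈S , λ { y (inj₁ y∈S) → least y y∈S ; y (inj₂ y∈T) → contradiction (y , y∈T) ∄T }
  ... | no ∄S | yes t = let m , m∈T , least = minT t in
    m , inj₂ m∈T , λ { y (inj₁ y∈S) → contradiction (y , y∈S) ∄S ; y (inj₂ y∈T) → least y y∈T }
  ... | yes s | yes t with minS s | minT t
  ...   | m , m∈S , least | m′ , m′∈T , least′ with ≤-total m m′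
  ...     | inj₁ m≤m′ = m , inj₁ m∈S ,
    λ { y (inj₁ y∈S) → least y y∈S ; y (inj₂ y∈T) → ≤-trans m≤m′ (least′ y y∈T) }
  ...     | inj₂ m′≤m = m′ , inj₂ m′∈T ,
    λ { y (inj₁ y∈S) → ≤-trans m′≤m (least y y∈S) ; y (inj₂ y∈T) → least′ y y∈T }

  module _ {G : LayeredGraph a} (nn : NonNegativeWeights G) where

    adjacent-nonNegative : Adjacent G u v w → 0# ≤ w
    adjacent-nonNegative (inj₁ e) = nn e
    adjacent-nonNegative (inj₂ e) = nn e

    via-nonNegative : ∀ {L} → Via G L u v r → 0# ≤ r
    via-nonNegative (edge e)    = adjacent-nonNegative e
    via-nonNegative (step e _ p) = 0≤x+y (adjacent-nonNegative e) (via-nonNegative p)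

    via-there : ∀ {L y} → Via G L u v r → Via G (y ∷ L) u v r
    via-there (edge e)      = edge e
    via-there (step e v∈L p) = step e (there v∈L) (via-there p)

    via-join : ∀ {L y} → Via G L u y r → Via G L y v s → Via G (y ∷ L) u v (r + s)
    via-join (edge e)      q = step e (here refl) (via-there q)
    via-join (step e v∈L p) q = subst (Via G _ _ _) (sym (+-assoc _ _ _)) (step e (there v∈L) (via-join p q))

    Through : List (Vertex G) → Vertex G → Vertex G → Vertex G → ℝ → Set
    Through L y u v r = ∃[ s ] ∃[ t ] Via G L u y s × Via G L y v t × s + t ≡ r

    -- Loops at y are removed.
    via-split : ∀ {L y} → Via G (y ∷ L) u v r → ∃[ s ] (Via G L u v s ⊎ Through L y u v s) × s ≤ r
    via-split (edge e) = _ , inj₁ (edge e) , ≤-refl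
    via-split (step {w = w} e (here refl) p) with via-split p
    ... | s , inj₁ q , s≤r = w + s , inj₂ (w , s , edge e , q , refl) , +-monoʳ-≤ w s≤r
    ... | _ , inj₂ (s , t , loop , q , refl) , s+t≤r =
      w + t , inj₂ (w , t , edge e , q , refl) , +-monoʳ-≤ w (≤-trans (y≤x+y (via-nonNegative loop)) s+t≤r)
    via-split (step {w = w} e (there v∈L) p) with via-split p
    ... | s , inj₁ q , s≤r = w + s , inj₁ (step e v∈L q) , +-monoʳ-≤ w s≤r
    ... | _ , inj₂ (s , t , q , q′ , refl) , s+t≤r =
      w + (s + t) , inj₂ (w + s , t , (step e v∈L q) , q′ , +-assoc w s t) , +-monoʳ-≤ w s+t≤r

    via-minimum : ∀ L u v → ∃ (Via G L u v) → ∃ (IsMinimum (Via G L u v))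
    via-minimum [] u v (r , p) with minimum-⊎ {Edge G u v} {Edge G v u} unique unique (r , single p)
      where
      single : ∀ {r} → Via G [] u v r → Adjacent G u v r
      single (edge e) = e
      unique : ∀ {u v} → ∃ (Edge G u v) → ∃ (IsMinimum (Edge G u v))
      unique (w , e) = w , e , λ w′ e′ → ≤-reflexive (Edge-unique e e′)
    ... | m , e , least = m , edge e , λ { y (edge e′) → least y e′ }
    via-minimum (y ∷ L) u v (r , p)
      with minimum-⊎ {Via G L u v} {Through L y u v} (via-minimum L u v) through
                     (_ , proj₁ (proj₂ (via-split p)))
      where
      through : ∃ (Through L y u v) → ∃ (IsMinimum (Through L y u v))
      through (_ , s , t , p , q , _) with via-minimum L u y (s , p) | via-minimum L y v (t , q)
      ... | m , p′ , least | m′ , q′ , least′ = m + m′ , (m , m′ , p′ , q′ , refl) ,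
        λ { _ (s , t , p , q , refl) → +-mono-≤ (least s p) (least′ t q) }
    ... | m , p′ , least = m , rejoin p′ , least′
      where
      rejoin : Via G L u v m ⊎ Through L y u v m → Via G (y ∷ L) u v m
      rejoin (inj₁ q)                      = via-there q
      rejoin (inj₂ (_ , _ , q , q′ , refl)) = via-join q q′
      least′ : ∀ r → Via G (y ∷ L) u v r → m ≤ r
      least′ r q with via-split q
      ... | s , q′ , s≤r = ≤-trans (least s q′) s≤r

    prepend : Adjacent G u v w → (p : Walk G v x) →
              v ≡ x ⊎ (∃[ r ] Via G (vertices G) v x r × r ≤ walkLength p) →
              ∃[ r ] Via G (vertices G) u x r × r ≤ w + walkLength p
    prepend e p (inj₁ refl)          = _ , edge e , x≤x+y (length-nonNegative nn p)
    prepend e p (inj₂ (r , q , r≤p)) = _ , step e (∈-vertices _) q , +-monoʳ-≤ _ r≤p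

    walk⇒via : (p : Walk G u v) → u ≡ v ⊎ (∃[ r ] Via G (vertices G) u v r × r ≤ walkLength p)
    walk⇒via []             = inj₁ refl
    walk⇒via (forward e p)  = inj₂ (prepend (inj₁ e) p (walk⇒via p))
    walk⇒via (backward e p) = inj₂ (prepend (inj₂ e) p (walk⇒via p))

    via⇒walk : ∀ {L} → Via G L u v r → ∃[ p ] walkLength {G = G} {u} {v} p ≡ r
    via⇒walk (edge (inj₁ e))     = forward e [] , +-identityʳ _
    via⇒walk (edge (inj₂ e))     = backward e [] , +-identityʳ _
    via⇒walk (step (inj₁ e) _ q) with via⇒walk q
    ... | p , refl = forward e p , refl
    via⇒walk (step (inj₂ e) _ q) with via⇒walk q
    ... | p , refl = backward e p , refl

    -- `Via` contains no empty walk, so coinciding ends are treated apart; there the empty walk is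
    -- shortest by nonnegativity.
    distance-exists : Walk G u v → ∃ (IsDistance G u v)
    distance-exists {u = u} {v} p with em {u ≡ v}
    ... | yes refl = 0# , ([] , refl) , λ { _ (q , refl) → length-nonNegative nn q }
    ... | no  u≢v with walk⇒via p
    ...   | inj₁ u≡v = contradiction u≡v u≢v
    ...   | inj₂ (r , q , _) with via-minimum (vertices G) u v (r , q)
    ...     | m , q′ , least with via⇒walk q′
    ...       | p′ , refl = m , (p′ , refl) , λ { _ (p″ , refl) → bound p″ (walk⇒via p″) }
      where
      bound : ∀ p″ → u ≡ v ⊎ (∃[ r ] Via G (vertices G) u v r × r ≤ walkLength p″) → m ≤ walkLength p″
      bound p″ (inj₁ u≡v)             = contradiction u≡v u≢v
      bound p″ (inj₂ (r , q , r≤p″))  = ≤-trans (least r q) r≤p″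

-- Following the hole by a walk in the graph.

module Tracking (em : ExcludedMiddle 0ℓ) (𝓡 : RealNumbers) (k : ℕ)
                (A : OverReals.OnlineTaxi 𝓡 (TreeMetric.tree em 𝓡) k) where
  open RealNumbers 𝓡
  open OverReals 𝓡
  open OrderedField em 𝓡
  open TreeMetric em 𝓡
  open SlotGame em 𝓡 k A
  open Copying em 𝓡 k A
  open Walks em 𝓡
  open Game

  module _ {a : ℕ} {G : LayeredGraph a} where

    record Near (u v : Vertex G) (r : ℝ) : Set where
      constructor near
      field
        walk   : Walk G u v
        short  : walkLength walk ≤ r

    near-resp : ∀ {u u′ v v′ r r′} → u ≡ u′ → v ≡ v′ → r ≡ r′ → Near u v r → Near u′ v′ r′
    near-resp refl refl refl n = n

    near-sym : ∀ {u v r} → Near u v r → Near v u r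
    near-sym (near p p≤r) = near (reverse p) (≤-trans (≤-reflexive (length-reverse p)) p≤r)

    near-append : ∀ {u v x r} → Near u v r → (p : Walk G v x) → Near u x (r + walkLength p)
    near-append (near q q≤r) p = near (q ++ʷ p)
      (≤-trans (≤-reflexive (length-++ q p)) (+-monoˡ-≤ _ q≤r))

    -- Distances between slots in the tree dominate distances in the graph.
    Close : Game (Vertex G) → Set
    Close S = ∀ i j → Near (tagOf S i) (tagOf S j) (d (at S i) (at S j))

    -- Between two layers the hole may move many times. The searcher's walk is the concatenation of
    -- the graph walks that correspond to these moves; `x₀` is what was travelled before, and
    -- `Close` keeps each piece within the payment.
    record Trail (v₀ : Vertex G) (x₀ : ℝ) (S : Game (Vertex G)) : Set where
      constructor trail
      field
        walk       : Walk G v₀ (tagOf S (hole S))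
        affordable : x₀ + walkLength walk ≤ paid S

    trail-continue : ∀ {v₀ x₀ r} {S S′ : Game (Vertex G)} → Trail v₀ x₀ S →
                     Near (tagOf S (hole S)) (tagOf S′ (hole S′)) r → paid S + r ≤ paid S′ → Trail v₀ x₀ S′
    trail-continue {x₀ = x₀} {r} {S} {S′} (trail q q≤) (near p p≤r) h = trail (q ++ʷ p) (begin
      x₀ + walkLength (q ++ʷ p)           ≡⟨ cong (x₀ +_) (length-++ q p) ⟩
      x₀ + (walkLength q + walkLength p)  ≡⟨ +-assoc _ _ _ ⟨
      (x₀ + walkLength q) + walkLength p  ≤⟨ +-mono-≤ q≤ p≤r ⟩
      paid S + r                          ≤⟨ h ⟩
      paid S′                             ∎)
      where open ≤-Reasoning

    module _ {S S′ : Game (Vertex G)} {j P v b} (shifted : Shifted S S′ j P v b)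
             (near-v : ∀ i → Near (tagOf S i) v (d (at S i) P)) where
      open Shifted shifted

      close-shift : Close S → Close S′
      close-shift close i l with i ≟ᶠ j | l ≟ᶠ j
      ... | yes refl | yes refl = near [] (d-nonNegative (at S′ j) (at S′ j))
      ... | no i≢j   | yes refl = near-resp (sym (tag-other i≢j)) (sym tag-self)
        (cong₂ d (sym (at-other i≢j)) (sym at-self)) (near-v i)
      ... | yes refl | no l≢j   = near-resp (sym tag-self) (sym (tag-other l≢j))
        (trans (d-sym (at S l) P) (cong₂ d (sym at-self) (sym (at-other l≢j)))) (near-sym (near-v l))
      ... | no i≢j   | no l≢j   = near-resp (sym (tag-other i≢j)) (sym (tag-other l≢j))
        (cong₂ d (sym (at-other i≢j)) (sym (at-other l≢j))) (close i l)

      trail-shift : ∀ {v₀ x₀} → Close S → Trail v₀ x₀ S → Trail v₀ x₀ S′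
      trail-shift {v₀} {x₀} close t = by-response response
        where
        by-response : Response S S′ j P → Trail v₀ x₀ S′
        by-response (elsewhere h≢j hole≡ paid≡) = trail-continue t
          (near-resp refl (sym (trans (cong (tagOf S′) hole≡) (tag-other h≢j))) refl (near [] ≤-refl))
          (≤-reflexive (trans (+-identityʳ _) (sym paid≡)))
        by-response (follows h≡j hole≡ paid≡) = trail-continue t
          (near-resp (cong (tagOf S) (sym h≡j)) (sym (trans (cong (tagOf S′) hole≡) tag-self)) refl (near-v j))
          (≤-reflexive (sym paid≡))
        by-response (jumps {l} h≡j l≢j hole≡ paid≡) = trail-continue t
          (near-resp (cong (tagOf S) (sym h≡j)) (sym (trans (cong (tagOf S′) hole≡) (tag-other l≢j)))
            (d-sym (at S j) (at S l)) (close j l))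
          (≤-reflexive (sym paid≡))

  module _ {a : ℕ} {G : LayeredGraph a} (nn : NonNegativeWeights G) {v₀ : Vertex G} {x₀ : ℝ} where

    Tracked : Game (Vertex G) → Set
    Tracked S = Close S × Trail v₀ x₀ S

    copy-tracked : ∀ {T T′ : Game (Vertex G)} {j m b} → Shifted T T′ j (at T m) (tagOf T m) b → Tracked T → Tracked T′
    copy-tracked {m = m} shifted (close , t) =
      close-shift shifted (λ i → close i m) close , trail-shift shifted (λ i → close i m) close t

    extendAll : (S : Game (Vertex G)) (τ : Fin k → Vertex G) (ω : ∀ j → Walk G (tagOf S j) (τ j)) → Tracked S →
                ∃[ S′ ] Tracked S′ × (∀ l → tagOf S′ l ≡ τ l × boundOf S′ l ≡ boundOf S l + walkLength (ω l))
    extendAll S τ ω tracked = go (allFin k) S tracked (λ l → inj₂ (∈-allFin l , refl , refl))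
      where
      Done Pending : Game (Vertex G) → Fin k → Set
      Done T l    = tagOf T l ≡ τ l × boundOf T l ≡ boundOf S l + walkLength (ω l)
      Pending T l = tagOf T l ≡ tagOf S l × boundOf T l ≡ boundOf S l
      go : ∀ js T → Tracked T → (∀ l → Done T l ⊎ (l ∈ js × Pending T l)) → ∃[ S′ ] Tracked S′ × (∀ l → Done S′ l)
      go [] T tr done = T , tr , λ l → finished (done l)
        where
        finished : ∀ {l} → Done T l ⊎ (l ∈ [] × Pending T l) → Done T l
        finished (inj₁ x) = x
      go (j ∷ js) T tr@(close , t) done = by-case (done j)
        where
        by-case : Done T j ⊎ (j ∈ j ∷ js × Pending T j) → ∃[ S′ ] Tracked S′ × (∀ l → Done S′ l)
        by-case (inj₁ done-j) = go js T tr λ l → skip (done l)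
          where
          skip : ∀ {l} → Done T l ⊎ (l ∈ j ∷ js × Pending T l) → Done T l ⊎ (l ∈ js × Pending T l)
          skip (inj₁ x)                = inj₁ x
          skip (inj₂ (here refl , _))  = inj₁ done-j
          skip (inj₂ (there l∈js , x)) = inj₂ (l∈js , x)
        by-case (inj₂ (_ , tag≡ , bound≡)) = extended (extend T j (τ j) (length-nonNegative nn (ω j)))
          where
          extended : ∃[ T′ ] ∃[ P ] Shifted T T′ j P (τ j) (boundOf T j + walkLength (ω j))
                          × (∀ i → d (at T i) P ≡ d (at T i) (at T j) + walkLength (ω j)) →
                     ∃[ S′ ] Tracked S′ × (∀ l → Done S′ l)
          extended (T′ , P , shifted , distance) =
            go js T′ (close-shift shifted near-τ close , trail-shift shifted near-τ close t) done′
            where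
            near-τ : ∀ i → Near (tagOf T i) (τ j) (d (at T i) P)
            near-τ i = near-resp refl refl (sym (distance i))
              (near-append (near-resp refl tag≡ refl (close i j)) (ω j))
            done′ : ∀ l → Done T′ l ⊎ (l ∈ js × Pending T′ l)
            done′ l with l ≟ᶠ j
            ... | yes refl = inj₁ (Shifted.tag-self shifted ,
                    trans (Shifted.bound-self shifted) (cong (_+ walkLength (ω j)) bound≡))
            ... | no l≢j with done l
            ...   | inj₁ (x , y) = inj₁ (trans (Shifted.tag-other shifted l≢j) x , trans (Shifted.bound-other shifted l≢j) y)
            ...   | inj₂ (here l≡j , _) = contradiction l≡j l≢j
            ...   | inj₂ (there l∈js , x , y) =
                    inj₂ (l∈js , trans (Shifted.tag-other shifted l≢j) x , trans (Shifted.bound-other shifted l≢j) y)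

    -- The copies are made before any extension, while their sources still stand in the old layer.
    -- Afterwards every slot is extended along a walk of its own.
    transition : (S : Game (Vertex G)) (μ : Fin k → Fin k) → (∀ j → μ (μ j) ≡ μ j) →
                 (τ : Fin k → Vertex G) (ω : ∀ j → Walk G (tagOf S (μ j)) (τ j)) → Tracked S →
                 ∃[ S′ ] Tracked S′ × (∀ l → tagOf S′ l ≡ τ l × boundOf S′ l ≡ boundOf S (μ l) + walkLength (ω l))
    transition S μ μ-idem τ ω tracked =
      copied (copyAll Tracked S μ μ-idem (λ _ shifted → copy-tracked shifted) tracked)
      where
      copied : ∃[ T ] Tracked T × (∀ l → SameSlot T l S (μ l)) →
               ∃[ S′ ] Tracked S′ × (∀ l → tagOf S′ l ≡ τ l × boundOf S′ l ≡ boundOf S (μ l) + walkLength (ω l))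
      copied (T , tracked-T , same) = result
          (extendAll T τ (proj₁ ∘ ω′) tracked-T)
        where
        tag≡ : ∀ l → tagOf T l ≡ tagOf S (μ l)
        tag≡ l = proj₁ (proj₂ (same l))
        ω′ : ∀ l → ∃[ p ] walkLength {u = tagOf T l} {τ l} p ≡ walkLength (ω l)
        ω′ l = relocate (sym (tag≡ l)) refl (ω l)
        result : ∃[ S′ ] Tracked S′ × (∀ l → tagOf S′ l ≡ τ l ×
                   boundOf S′ l ≡ boundOf T l + walkLength (proj₁ (ω′ l))) →
                 ∃[ S′ ] Tracked S′ × (∀ l → tagOf S′ l ≡ τ l × boundOf S′ l ≡ boundOf S (μ l) + walkLength (ω l))
        result (S′ , tracked′ , spec) = S′ , tracked′ , λ l → proj₁ (spec l) ,
          trans (proj₂ (spec l)) (cong₂ _+_ (proj₂ (proj₂ (same l))) (proj₂ (ω′ l)))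

-- The online searcher and its competitiveness.

module Searcher (em : ExcludedMiddle 0ℓ) (𝓡 : RealNumbers) (k : ℕ)
                (A : OverReals.OnlineTaxi 𝓡 (TreeMetric.tree em 𝓡) k) (i₀ : Fin k) where
  open RealNumbers 𝓡
  open OverReals 𝓡
  open OrderedField em 𝓡
  open TreeMetric em 𝓡
  open SlotGame em 𝓡 k A
  open Walks em 𝓡
  open Tracking em 𝓡 k A
  open Game

  -- The state after reaching the last layer of `G`. `covers` says that each reachable vertex of
  -- this layer has a slot whose bound is at most its distance from the source within `G`.
  record Search {a} (G : LayeredGraph a) : Set where
    field
      game    : Game (Fin a)
      total   : ℝ
      total≤  : total ≤ paid game
      close   : ∀ i j → Near {G = G} (last (tagOf game i)) (last (tagOf game j)) (d (at game i) (at game j))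
      covers  : ∀ u (p : Walk G (source G) (last u)) →
                ∃[ i ] tagOf game i ≡ u × boundOf game i ≤ walkLength p

    position : Fin a
    position = tagOf game (hole game)

  open Search

  start-search : Search start
  start-search = record
    { game   = initial i₀ zero
    ; total  = 0#
    ; total≤ = ≤-refl
    ; close  = λ i j → near-resp (only _) (only _) refl (near [] (d-nonNegative (at (initial {Fin 1} i₀ zero) i) (at (initial {Fin 1} i₀ zero) j)))
    ; covers = λ { zero p → i₀ , lookup-replicate i₀ zero ,
                   ≤-trans (≤-reflexive (lookup-replicate i₀ 0#)) (length-nonNegative (λ ()) p) }
    }
    where
    only : (u : Fin 1) → last {G = start} zero ≡ last u
    only zero = refl

  module _ {a b : ℕ} (G : LayeredGraph a) (E : Edges a b) where

    module FromSearch (nn : NonNegativeWeights (G ▷ E)) (S : Search G) where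

      -- A slot from which u is reached along a shortest walk from the source; if u
      -- is unreachable another target is chosen.
      record Supply (u : Fin b) : Set where
        field
          target : Fin b
          slot′  : Fin k
          route  : Walk (G ▷ E) (older (last (tagOf (game S) slot′))) (last target)
          best   : (p : Walk (G ▷ E) (source (G ▷ E)) (last u)) →
                   target ≡ u × boundOf (game S) slot′ + walkLength route ≤ walkLength p

      -- The part of a shortest walk before its first visit to the previous layer lies in `G`, so
      -- `covers` bounds it by a slot. The remainder, which may go back and forth, becomes the
      -- route.
      reachable-supply : ∀ u → Walk (G ▷ E) (source (G ▷ E)) (last u) → Σ[ s ∈ Supply u ] Supply.target s ≡ u
      reachable-supply u p₀ with distance-exists nn p₀
      ... | _ , (p , refl) , least with first-visit p
      ...   | v , q , r , qr≡p with covers S v q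
      ...     | i , refl , bound≤q = record
        { target = u ; slot′ = i ; route = r
        ; best = λ p′ → refl , ≤-trans (+-monoˡ-≤ _ bound≤q) (≤-trans (≤-reflexive qr≡p) (least _ (p′ , refl)))
        } , refl

      supply : ∀ {u₀} → Walk (G ▷ E) (source (G ▷ E)) (last u₀) → ∀ u → Supply u
      supply {u₀} p₀ u with em {Walk (G ▷ E) (source (G ▷ E)) (last u)}
      ... | yes p = proj₁ (reachable-supply u p)
      ... | no ¬p = record { target = target ; slot′ = slot′ ; route = route ; best = λ p → contradiction p ¬p }
        where open Supply (proj₁ (reachable-supply u₀ p₀))

      embedded : Game (Vertex (G ▷ E))
      embedded = retag (λ i → older (last (tagOf (game S) i))) (game S)

      embedded-tag : ∀ i → tagOf embedded i ≡ older (last (tagOf (game S) i))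
      embedded-tag = lookup∘tabulate (λ i → older (last (tagOf (game S) i)))

      here₀ : Vertex (G ▷ E)
      here₀ = older (last (position S))

      embedded-tracked : Tracked nn {here₀} {total S} embedded
      embedded-tracked =
        (λ i j → near-resp (sym (embedded-tag i)) (sym (embedded-tag j)) refl (lift-near (close S i j))) ,
        trail-resp (sym (embedded-tag (hole (game S)))) (≤-trans (≤-reflexive (+-identityʳ _)) (total≤ S))
        where
        lift-near : ∀ {u v r} → Near {G = G} u v r → Near {G = G ▷ E} (older u) (older v) r
        lift-near (near p p≤r) = near (olderʷ p) (≤-trans (≤-reflexive (length-older p)) p≤r)
        trail-resp : here₀ ≡ tagOf embedded (hole embedded) → total S + 0# ≤ paid embedded → Trail here₀ (total S) embedded
        trail-resp eq h = trail (proj₁ (stay eq)) (≤-trans (≤-reflexive (cong (total S +_) (proj₂ (stay eq)))) h)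
          where
          stay : here₀ ≡ tagOf embedded (hole embedded) → ∃[ p ] walkLength {u = here₀} {tagOf embedded (hole embedded)} p ≡ 0#
          stay eq = relocate {G = G ▷ E} refl eq []

      moved : (μ : Fin k → Fin k) → (∀ j → μ (μ j) ≡ μ j) → (τ : Fin k → Fin b) →
              (ω : ∀ j → Walk (G ▷ E) (older (last (tagOf (game S) (μ j)))) (last (τ j))) →
              ∃[ S′ ] Tracked nn {here₀} {total S} S′
                    × (∀ l → tagOf S′ l ≡ last (τ l) × boundOf S′ l ≡ boundOf (game S) (μ l) + walkLength (ω l))
      moved μ μ-idem τ ω = result (transition nn embedded μ μ-idem (last ∘ τ) (proj₁ ∘ ω′) embedded-tracked)
        where
        ω′ : ∀ l → ∃[ p ] walkLength {u = tagOf embedded (μ l)} {last (τ l)} p ≡ walkLength (ω l)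
        ω′ l = relocate (sym (embedded-tag (μ l))) refl (ω l)
        result : ∃[ S′ ] Tracked nn {here₀} {total S} S′
                    × (∀ l → tagOf S′ l ≡ last (τ l) × boundOf S′ l ≡ boundOf (game S) (μ l) + walkLength (proj₁ (ω′ l))) →
                 ∃[ S′ ] Tracked nn {here₀} {total S} S′
                       × (∀ l → tagOf S′ l ≡ last (τ l) × boundOf S′ l ≡ boundOf (game S) (μ l) + walkLength (ω l))
        result (S′ , tr , spec) = S′ , tr , λ l → proj₁ (spec l) ,
          trans (proj₂ (spec l)) (cong (boundOf (game S) (μ l) +_) (proj₂ (ω′ l)))

    -- What an instance guarantees at this layer, collected so that `em` can decide it; on other
    -- inputs the searcher gives up. A reachable vertex exists because a walk to a later target has
    -- to cross the layer.
    record Ready : Set where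
      field
        narrow      : b ℕ.≤ k
        nonNegative : NonNegativeWeights (G ▷ E)
        someVertex  : Fin b
        someWalk    : Walk (G ▷ E) (source (G ▷ E)) (last someVertex)

    record Finishable (t : Fin b) : Set where
      field
        nonNegative : NonNegativeWeights (G ▷ E)
        someWalk    : Walk (G ▷ E) (source (G ▷ E)) (last t)

    record Advance (S : Search G) : Set where
      field
        next    : Search (G ▷ E)
        walk    : Walk (G ▷ E) (older (last (position S))) (last (position next))
        total-≡ : total next ≡ total S + walkLength walk

    record Finish (S : Search G) (t : Fin b) : Set where
      field
        end    : Game (Vertex (G ▷ E))
        walk   : Walk (G ▷ E) (older (last (position S))) (last t)
        affordable : total S + walkLength walk ≤ paid end
        best   : (p : Walk (G ▷ E) (source (G ▷ E)) (last t)) → boundOf end i₀ ≤ walkLength p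

    opaque
      step-search : (S : Search G) → Ready → Advance S
      step-search S ready = result (moved μ μ-idem τ ω)
        where
        open Ready ready
        open FromSearch nonNegative S
        open Supply
        sup : ∀ u → Supply u
        sup = supply someWalk
        f : Fin b → Fin k
        f u = slot′ (sup u)
        placed : Placement f
        placed = place someVertex f narrow
          where
          place : ∀ {b} → Fin b → (f : Fin b → Fin k) → b ℕ.≤ k → Placement f
          place {suc b} _ f = placement f
        F : Fin k → Fin b
        F = proj₁ placed
        μ : Fin k → Fin k
        μ j = f (F j)
        μ-idem : ∀ j → μ (μ j) ≡ μ j
        μ-idem j with proj₂ (proj₂ placed) (μ j)
        ... | inj₁ own  = own
        ... | inj₂ free = contradiction refl (free (F j))
        τ : Fin k → Fin b
        τ j = target (sup (F j))
        ω : ∀ j → Walk (G ▷ E) (older (last (tagOf (game S) (μ j)))) (last (τ j))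
        ω j = route (sup (F j))
        result : ∃[ T ] Tracked nonNegative {here₀} {total S} T
                      × (∀ l → tagOf T l ≡ last (τ l) × boundOf T l ≡ boundOf (game S) (μ l) + walkLength (ω l)) →
                 Advance S
        result (T , (close-T , trail q q≤) , spec) = record
          { next = S′ ; walk = proj₁ walk′ ; total-≡ = cong (total S +_) (sym (proj₂ walk′)) }
          where
          tag≡ : ∀ l → tagOf T l ≡ last (tagOf (retag τ T) l)
          tag≡ l = trans (proj₁ (spec l)) (cong last (sym (lookup∘tabulate τ l)))
          walk′ : ∃[ p′ ] walkLength {u = here₀} {last (tagOf (retag τ T) (hole T))} p′ ≡ walkLength q
          walk′ = relocate refl (tag≡ (hole T)) q
          S′ : Search (G ▷ E)
          S′ = record
            { game   = retag τ T
            ; total  = total S + walkLength q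
            ; total≤ = q≤
            ; close  = λ i j → near-resp (tag≡ i) (tag≡ j) refl (close-T i j)
            ; covers = covers′
            }
            where
            covers′ : ∀ u (p : Walk (G ▷ E) (source (G ▷ E)) (last u)) →
                      ∃[ i ] tagOf (retag τ T) i ≡ u × boundOf T i ≤ walkLength p
            covers′ u p with proj₁ (proj₂ placed) u
            ... | j , refl = j , trans (lookup∘tabulate τ j) (proj₁ (best (sup (F j)) p)) ,
                             ≤-trans (≤-reflexive (proj₂ (spec j))) (proj₂ (best (sup (F j)) p))

      -- Once all slots are at t, so is the searcher.
      finish-search : (S : Search G) (t : Fin b) → Finishable t →
                      Finish S t
      finish-search S t finishable = result (moved (λ _ → slot′) (λ _ → refl) (λ _ → target) (λ _ → route))
        where
        open Finishable finishable renaming (nonNegative to nn; someWalk to p₀)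
        open FromSearch nn S
        open Supply (proj₁ (reachable-supply t p₀))
        target≡t : target ≡ t
        target≡t = proj₂ (reachable-supply t p₀)
        result : ∃[ T ] Tracked nn {here₀} {total S} T
                      × (∀ l → tagOf T l ≡ last target × boundOf T l ≡ boundOf (game S) slot′ + walkLength route) →
                 Finish S t
        result (T , (_ , trail q q≤) , spec) = record
          { end    = T
          ; walk   = proj₁ q′
          ; affordable = ≤-trans (≤-reflexive (cong (total S +_) (proj₂ q′))) q≤
          ; best   = λ p → ≤-trans (≤-reflexive (proj₂ (spec i₀))) (proj₂ (best p))
          }
          where
          q′ : ∃[ p′ ] walkLength {u = here₀} {last t} p′ ≡ walkLength q
          q′ = relocate refl (trans (proj₁ (spec (hole T))) (cong last target≡t)) q

  -- The searcher has no memory, so its state is recomputed from the revealed graph. The decision is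
  -- an argument of `extendSearch`, so that `arrives` can replace `em` by a `yes`.
  search : ∀ {a} (G : LayeredGraph a) → Maybe (Search G)
  extendSearch : ∀ {a b} (G : LayeredGraph a) (E : Edges a b) → Maybe (Search G) → Dec (Ready G E) → Maybe (Search (G ▷ E))

  search start   = just start-search
  search (G ▷ E) = extendSearch G E (search G) em

  extendSearch G E (just S) (yes ready) = just (Advance.next (step-search G E S ready))
  extendSearch G E (just S) (no _)      = nothing
  extendSearch G E nothing  _           = nothing

  module _ {a b} (G : LayeredGraph a) (E : Edges a b) where

    -- `arrives` shows that on instances the searcher reaches each layer at `position S`; the other
    -- answers are default values.
    go-on : Maybe (Search G) → Dec (Ready G E) → (v : Fin a) → Maybe (∃[ j ] Walk (G ▷ E) (older (last v)) (last j))
    go-on nothing  _           v = nothing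
    go-on (just S) (no _)      v = nothing
    go-on (just S) (yes ready) v with position S ≟ᶠ v
    ... | yes refl = just (-, Advance.walk (step-search G E S ready))
    ... | no  _    = nothing

    go-home : Maybe (Search G) → ∀ t → Dec (Finishable G E t) → (v : Fin a) → Maybe (Walk (G ▷ E) (older (last v)) (last t))
    go-home nothing  t _              v = nothing
    go-home (just S) t (no _)         v = nothing
    go-home (just S) t (yes finishable) v with position S ≟ᶠ v
    ... | yes refl = just (Finish.walk (finish-search G E S t finishable))
    ... | no  _    = nothing

  searcher : OnlineSearcher
  searcher = record
    { advance = λ G E v → go-on G E (search G) em v
    ; finish  = λ G E t v → go-home G E (search G) t em v
    }

  width-before : ∀ {a b} {G : LayeredGraph a} {E : Edges a b} → Width≤ k (G ▷ E) → Width≤ k G × b ℕ.≤ k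
  width-before (w ▷ b≤k) = w , b≤k

  go-on-yes : ∀ {a b} (G : LayeredGraph a) (E : Edges a b) S ready →
              go-on G E (just S) (yes ready) (position S) ≡
              just (-, Advance.walk (step-search G E S ready))
  go-on-yes G E S ready with position S ≟ᶠ position S
  ... | yes refl = refl
  ... | no  ≢    = contradiction refl ≢

  go-home-yes : ∀ {a b} (G : LayeredGraph a) (E : Edges a b) S t finishable →
                go-home G E (just S) t (yes finishable) (position S) ≡ just (Finish.walk (finish-search G E S t finishable))
  go-home-yes G E S t finishable with position S ≟ᶠ position S
  ... | yes refl = refl
  ... | no  ≢    = contradiction refl ≢

  yes-of : ∀ {P : Set} (P? : Dec P) → P → ∃[ p ] P? ≡ yes p
  yes-of (yes p) _ = p , refl
  yes-of (no ¬p) p = contradiction p ¬p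

  -- The walk to `u`, cut at its first visit to the previous layer, serves as the witness of
  -- reachability for the induction, and the whole walk makes the new layer `Ready`.
  arrives : ∀ {a} (G : LayeredGraph a) → Width≤ k G → NonNegativeWeights G → ∀ u → Walk G (source G) (last u) →
            ∃[ S ] search G ≡ just S × Arrives searcher G (position S) (total S)
  arrives start _ _ _ _ = start-search , refl , subst (λ v → Arrives searcher start v 0#) (only _) start
    where
    only : (v : Fin 1) → zero ≡ v
    only zero = refl
  arrives (G ▷ E) w nn u p with first-visit p | width-before w
  ... | v , q , _ | w′ , b≤k with arrives G w′ (nn ∘ older) v q
                                | yes-of (em {Ready G E}) (record { narrow = b≤k ; nonNegative = nn ; someVertex = u ; someWalk = p })
  ...   | S , search≡ , arr | ready , em≡ = next , cong₂ (extendSearch G E) search≡ em≡ ,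
      subst (Arrives searcher (G ▷ E) (position next)) (sym total-≡)
        (step arr (trans (cong₂ (λ s r → go-on G E s r (position S)) search≡ em≡) (go-on-yes G E S ready)))
      where open Advance (step-search G E S ready)

  module _ {ρ c : ℝ} (competitive : ∀ σ → ∃[ opt ] OverReals.IsOptimalServiceCost 𝓡 tree k root σ opt
             × LazySimulation.serviceCost em 𝓡 tree k root σ (LazySimulation.actions em 𝓡 tree k A [] σ) ≤ ρ * opt + c) where

    searcher-competitive : IsLGTCompetitive k ρ searcher
    searcher-competitive = c , reach
      where
      0≤ρ : 0# ≤ ρ
      0≤ρ = competitive⇒0≤ρ i₀ competitive
      reach : ∀ {a} (G : LayeredGraph a) (t : Fin a) → IsInstance k G t →
              ∃[ x ] ∃[ opt ] Finishes searcher G t x × IsDistance G (source G) (last t) opt × x ≤ ρ * opt + c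
      -- Here the claim amounts to a nonnegative `c`, which is competitiveness on the empty request
      -- sequence, obtained from the initial game.
      reach start zero inst = 0# , 0# , start , (([] , refl) , λ { _ (p , refl) → length-nonNegative (λ ()) p }) ,
        subst (λ z → 0# ≤ ρ * z + c) (lookup-replicate i₀ 0#) (paid≤ 0≤ρ competitive (initial {⊤} i₀ tt) i₀)
      reach (G ▷ E) t inst with first-visit reachable | width-before width | distance-exists nonNegative reachable
        where open IsInstance inst
      ... | v , q , _ | w , _ | opt , dist@((p , opt≡p) , _)
        with arrives G w (IsInstance.nonNegative inst ∘ older) v q
           | yes-of (em {Finishable G E t}) (record { nonNegative = IsInstance.nonNegative inst ; someWalk = IsInstance.reachable inst })
      ...   | S , search≡ , arr | finishable , em≡ = _ , opt ,
        step arr (trans (cong₂ (λ s r → go-home G E s t r (position S)) search≡ em≡) (go-home-yes G E S t finishable)) ,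
        dist ,
        (begin
          total S + walkLength walk ≤⟨ affordable ⟩
          paid end                  ≤⟨ paid≤ 0≤ρ competitive end i₀ ⟩
          ρ * boundOf end i₀ + c    ≤⟨ +-monoˡ-≤ c (*-monoʳ-≤ 0≤ρ (≤-trans (best p) (≤-reflexive (sym opt≡p)))) ⟩
          ρ * opt + c               ∎)
        where
        open ≤-Reasoning
        open Finish (finish-search G E S t finishable)

-- Reduction, existence of the ratio and its exponential growth.

theorem3 :
    ExcludedMiddle (lsuc 0ℓ) →
    (𝓡 : RealNumbers) →
    let open RealNumbers 𝓡
        open OverReals 𝓡
    in
    ((k : ℕ) → 1 ℕ.≤ k → (ρ : ℝ) → TaxiCompetitive k ρ → LGTCompetitive k ρ)
    ×
    (∃[ ratio ] ((k : ℕ) → 1 ℕ.≤ k → TaxiCompetitiveRatio k (ratio k))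
              × ratio ∈Ω (λ k → 2# ^ k))
theorem3 em 𝓡 = reduction , ratio , isRatio , c , 0<c , 1 , isΩ
  where
  open RealNumbers 𝓡
  open OverReals 𝓡
  open AddExtrema _≤_ using () renaming ([_] to [_]≤)
  em₀ : ExcludedMiddle 0ℓ
  em₀ {P} = map′ lower lift (em {Lift (lsuc 0ℓ) P})
  open TreeMetric em₀ 𝓡 using (tree)
  open LowerBound em₀ 𝓡 using (quarter; TaxiCompetitive⇒2^k≤4ρ)

  reduction : (k : ℕ) → 1 ℕ.≤ k → (ρ : ℝ) → TaxiCompetitive k ρ → LGTCompetitive k ρ
  reduction k 1≤k ρ taxi = searcher , searcher-competitive (proj₂ (proj₂ (taxi tree (Vec.replicate k []))))
    where open Searcher em₀ 𝓡 k (proj₁ (taxi tree (Vec.replicate k []))) (fromℕ< 1≤k)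

  c = proj₁ quarter
  0<c = proj₁ (proj₂ quarter)

  bounded : ∀ k x → TaxiCompetitive (suc k) x → c * 2# ^ suc k ≤ x
  bounded k x = TaxiCompetitive⇒2^k≤4ρ k

  inf : ∀ k → ∃[ r ] IsInfimum (TaxiCompetitive (suc k)) r
  inf k = Infima.infimum em 𝓡 (TaxiCompetitive (suc k)) (c * 2# ^ suc k , bounded k)

  ratio : ℕ → ℝ±
  -- An arbitrary value: both claims about `ratio` start at one taxi.
  ratio zero    = ⊤±
  ratio (suc k) = proj₁ (inf k)

  isRatio : (k : ℕ) → 1 ℕ.≤ k → TaxiCompetitiveRatio k (ratio k)
  isRatio (suc k) _ = proj₂ (inf k)

  isΩ : ∀ k → 1 ℕ.≤ k → [ c * 2# ^ k ] ≤± ratio k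
  isΩ (suc k) _ = proj₂ (proj₂ (inf k)) [ c * 2# ^ suc k ] (λ x comp → [ bounded k x comp ]≤)
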